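{- Let $A\in\mathbb R^{n\times d}$ and let $p\ge1$ (with $p<\infty$). Then there exists $U\in\mathbb R^{n\times s}$ for some $s=O(d\log\log d)$ such that (1) $\|U\|_{p,p}\le s^{1/p}$, and (2) for any $x\in\mathbb R^d$ there exists $z\in\mathbb R^s$ such that $Ax=Uz$ and $\|z\|_2\le O(1)\,\|Uz\|_p$.
   Context: $\|U\|_{p,p}=\big(\sum_{i,j}|U_{i,j}|^p\big)^{1/p}$ is the entrywise $\ell_p$ norm. $O(\cdot)$ hides absolute constants; $\log\log d$ is read as at least $1$. -}

module Defs where

open import Level using (0ℓ) renaming (suc to lsuc)
open import Algebra.Bundles using (CommutativeRing; Semiring)
open import Axiom.ExcludedMiddle using (ExcludedMiddle)
open import Data.Nat.Base as ℕ using (ℕ; suc)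
open import Data.Nat.Logarithm using (⌊log₂_⌋)
open import Data.Product.Base using (∃; ∃-syntax; _×_; proj₁)
open import Data.Sum.Base using (_⊎_)
open import Data.Vec.Functional using (Vector; map; zipWith)
open import Relation.Binary.Bundles using (TotalOrder)
open import Relation.Binary.Core using (Rel)
open import Relation.Binary.Structures using (IsTotalOrder)
open import Relation.Nullary.Decidable.Core using (yes; no)
open import Relation.Nullary.Negation.Core using (¬_)
open import Relation.Unary using (Pred; Satisfiable)
import Algebra.Construct.NaturalChoice.Max as Max
import Algebra.Definitions.RawSemiring as RawSemiringDefs

-- The real numbers, axiomatised as a Dedekind-complete totally ordered field.
-- Classically these axioms are categorical.  As 0# ⁻¹ is unconstrained, the
-- total inverse carries no extra information.

record CompleteOrderedField : Set (lsuc 0ℓ) where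
  infix 4 _≤_
  infix 8 _⁻¹
  field
    commutativeRing : CommutativeRing 0ℓ 0ℓ
  open CommutativeRing commutativeRing public renaming (Carrier to ℝ)
  field
    _≤_          : Rel ℝ 0ℓ
    isTotalOrder : IsTotalOrder _≈_ _≤_
    +-monoˡ-≤    : ∀ {x y} z → x ≤ y → x + z ≤ y + z
    *-nonNeg     : ∀ {x y} → 0# ≤ x → 0# ≤ y → 0# ≤ x * y
    _⁻¹          : ℝ → ℝ
    ⁻¹-inverseʳ  : ∀ {x} → ¬ (x ≈ 0#) → x * x ⁻¹ ≈ 1#
    0≉1          : ¬ (0# ≈ 1#)

  UpperBound : Pred ℝ 0ℓ → Pred ℝ 0ℓ
  UpperBound P u = ∀ {x} → P x → x ≤ u

  IsLub : Pred ℝ 0ℓ → Pred ℝ 0ℓ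
  IsLub P u = UpperBound P u × (∀ {v} → UpperBound P v → u ≤ v)

  field
    complete : ∀ P → Satisfiable P → Satisfiable (UpperBound P) → ∃ (IsLub P)

  totalOrder : TotalOrder 0ℓ 0ℓ 0ℓ
  totalOrder = record { isTotalOrder = isTotalOrder }

module RealAnalysis (em : ExcludedMiddle 0ℓ) (R : CompleteOrderedField) where

  open CompleteOrderedField R public
  open Max totalOrder public using (_⊔_)
  open RawSemiringDefs (Semiring.rawSemiring semiring) public using (sum; _^_) renaming (_×_ to _·_)

  fromℕ : ℕ → ℝ
  fromℕ n = n · 1#

  ∣_∣ : ℝ → ℝ
  ∣ x ∣ = x ⊔ (- x)

  -- The least upper bound of P if it has one, and 0 otherwise.

  sup : Pred ℝ 0ℓ → ℝ
  sup P with em {∃ (IsLub P)}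
  ... | yes lub = proj₁ lub
  ... | no  _   = 0#

  -- Real powers x ^ᴿ a, meaningful for x ≥ 0 and a > 0, as the supremum of the
  -- rational powers of x that do not exceed it: those with exponent
  -- m / suc n ≤ a if x ≥ 1, and with exponent m / suc n ≥ a if x ≤ 1.  The
  -- inequality t ≤ x ^ (m / suc n) is written t ^ suc n ≤ x ^ m.  For x ≥ 0
  -- and a > 0 the set is inhabited and bounded above, and 0# ^ᴿ a ≈ 0#.

  BelowPower : ℝ → ℝ → Pred ℝ 0ℓ
  BelowPower x a t =
    0# ≤ t × ∃[ m ] ∃[ n ]
      ( ( (1# ≤ x × fromℕ m ≤ fromℕ (suc n) * a)
        ⊎ (x ≤ 1# × fromℕ (suc n) * a ≤ fromℕ m))
      × t ^ suc n ≤ x ^ m)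

  infixr 8 _^ᴿ_
  _^ᴿ_ : ℝ → ℝ → ℝ
  x ^ᴿ a = sup (BelowPower x a)

  Matrix : ℕ → ℕ → Set
  Matrix n d = Vector (Vector ℝ d) n

  infixr 7 _*ᵥ_
  _*ᵥ_ : ∀ {n d} → Matrix n d → Vector ℝ d → Vector ℝ n
  (A *ᵥ x) i = sum (zipWith _*_ (A i) x)

  ‖_‖[_] : ∀ {n} → Vector ℝ n → ℝ → ℝ
  ‖ x ‖[ p ] = sum (map (λ t → ∣ t ∣ ^ᴿ p) x) ^ᴿ (p ⁻¹)

  ‖_‖₂ : ∀ {n} → Vector ℝ n → ℝ
  ‖ x ‖₂ = ‖ x ‖[ fromℕ 2 ]

  ‖_‖ₑ[_] : ∀ {n s} → Matrix n s → ℝ → ℝ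
  ‖ U ‖ₑ[ p ] = sum (map (λ u → sum (map (λ t → ∣ t ∣ ^ᴿ p) u)) U) ^ᴿ (p ⁻¹)

-- log log d, read as at least 1.  The base and the rounding change it by at
-- most a constant factor.

loglog : ℕ → ℕ
loglog d = 1 ℕ.⊔ ⌊log₂ ⌊log₂ d ⌋ ⌋

{-# OPTIONS --safe #-}

-- Let K be the unit ball of the ℓₚ norm on the column space of A.  Start from M₀ = δ² I, the Gram
-- matrix of the vectors δ eₖ, with δ so small that they lie in K, and choose 3d further vectors of K
-- that almost maximise det M, where M = M₀ + Σ u uᵀ.  Since tr (M⁻¹ M) = d, some chosen u has
-- uᵀ M⁻¹ u ≤ 1/2, and exchanging it for any y in K shows yᵀ M⁻¹ y ≤ 4.  The coefficients
-- z_w = yᵀ M⁻¹ w then represent y exactly, with ‖ z ‖₂² = yᵀ M⁻¹ y, and all 4d vectors w lie in K.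
-- So s = 4d columns suffice, without the factor log log d.

module Submission where

open import Level using (0ℓ)
open import Axiom.ExcludedMiddle using (ExcludedMiddle)
open import Data.Nat.Base using (ℕ) renaming (_≤_ to _≤ℕ_; _*_ to _*ℕ_)
open import Data.Product.Base using (Σ-syntax; _×_)
open import Data.Vec.Functional using (Vector)
open import Defs

open import Algebra.Bundles.Raw using (RawRing)
open import Algebra.Solver.Ring.AlmostCommutativeRing using (_-Raw-AlmostCommutative⟶_; fromCommutativeRing)
open import Data.Empty using (⊥-elim)
open import Data.Fin.Base using (Fin; zero; suc)
open import Data.Integer.Base as ℤ using (ℤ; +_; -[1+_]; _⊖_)
import Data.Integer.Properties as ℤ
open import Data.List.Base as List using (List; []; _∷_; length; replicate)
import Data.List.Properties as List
open import Data.List.Membership.Propositional using (_∈_)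
open import Data.List.Membership.Propositional.Properties using (∈-∃++)
open import Data.List.Relation.Binary.Permutation.Propositional as Perm using (_↭_)
open import Data.List.Relation.Binary.Permutation.Propositional.Properties using (shift; ↭-length; All-resp-↭)
open import Data.List.Relation.Unary.All as All using (All; []; _∷_)
import Data.List.Relation.Unary.All.Properties as All
open import Data.Maybe.Base using (Maybe; just; nothing)
open import Data.Nat.Base as ℕ using (zero; suc)
open import Data.Nat.Logarithm using (⌊log₂_⌋)
import Data.Nat.Properties as ℕ
open import Data.Product.Base using (∃; ∃-syntax; _,_; proj₁; proj₂)
open import Data.Sum.Base using (_⊎_; inj₁; inj₂; [_,_]′)
import Data.Vec.Functional as Vector
open import Relation.Binary.Bundles using (TotalOrder)
open import Relation.Binary.PropositionalEquality as ≡ using (_≡_)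
open import Relation.Nullary using (¬_; yes; no)
open import Relation.Unary using (Satisfiable)

-- The determinant argument runs on coefficient vectors in ℝ^d, where a kernel of `A` would make the
-- set of x with ‖Ax‖ₚ ≤ 1 unbounded and leave det M without a supremum. So `K` also bounds the
-- coordinates, and `bounded-preimage` shows that the truncated set still reaches every point of the
-- ball in the column space. The term δ² I keeps M invertible whatever the rank of `A`. Completeness
-- yields a supremum of det M but no maximiser, hence maximality up to a factor 2. If all 3d chosen
-- vectors had uᵀ M⁻¹ u > 1/2, the trace would exceed 3d/2 > d. Removing a vector with value at most
-- 1/2 divides det M by at most 2; with the slack 2 this gives the bound 4, whose square root is the
-- constant `fromℕ 2`. M⁻¹ is never formed as a matrix: it is a bilinear form updated by one vector
-- at a time, so its independence of the order, needed to take out an arbitrary chosen vector, has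
-- to be proved. Real powers are suprema of rational powers; their laws come from comparing integer
-- powers up to constant factors, which disappear as the exponent grows.

module Development (em : ExcludedMiddle 0ℓ) (R : CompleteOrderedField) where

  open RealAnalysis em R hiding (zero)
  open import Algebra.Construct.NaturalChoice.Max totalOrder using (⊔-lub; ⊔-sel; x≤x⊔y; x≤y⊔x)
  open import Algebra.Properties.AbelianGroup +-abelianGroup
    using (⁻¹-∙-comm) renaming (⁻¹-involutive to -‿involutive; ε⁻¹≈ε to -0≈0)
  open import Algebra.Properties.CommutativeSemiring.Exp commutativeSemiring
    using (^-homo-*; ^-assocʳ; ^-congˡ; ^-congʳ; ^-distrib-*)
  open import Algebra.Properties.Ring ring using (-‿distribˡ-*; -‿distribʳ-*)
  open import Algebra.Properties.Semiring.Mult semiring using (×1-homo-*; ×-homo-+; ×-congˡ)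
  import Algebra.Properties.Semiring.Mult.TCOptimised semiring as Opt
  open import Algebra.Properties.Semiring.Sum semiring
    using (sum-cong-≋; ∑-distrib-+; ∑-comm; *-distribˡ-sum; *-distribʳ-sum; sum-replicate; sum-replicate-zero)
  open TotalOrder totalOrder using (poset; total)
    renaming (refl to ≤-refl; reflexive to ≤-reflexive; trans to ≤-trans; antisym to ≤-antisym)
  import Relation.Binary.Reasoning.PartialOrder poset as ≤-Reasoning
  import Relation.Binary.Reasoning.Setoid setoid as ≈-Reasoning

  -- A ring solver with integer coefficients

  ℤ-rawRing : RawRing 0ℓ 0ℓ
  ℤ-rawRing = record { Carrier = ℤ ; _≈_ = _≡_ ; _+_ = ℤ._+_ ; _*_ = ℤ._*_ ; -_ = ℤ.-_ ; 0# = + 0 ; 1# = + 1 }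

  -- The optimised multiple makes `con (+ 1)` evaluate to `1#` itself. In contrast `fromℕ 2` unfolds
  -- to `1# + (1# + 0#)`, which is why the solver calls spell numerals as nested sums ending in
  -- `con (+ 0)`.
  ⟦_⟧ℤ : ℤ → ℝ
  ⟦ + n ⟧ℤ      = n Opt.× 1#
  ⟦ -[1+ n ] ⟧ℤ = - (suc n Opt.× 1#)

  ⟦⟧-neg : ∀ i → ⟦ ℤ.- i ⟧ℤ ≈ - ⟦ i ⟧ℤ
  ⟦⟧-neg (+ zero)    = sym -0≈0
  ⟦⟧-neg (+ suc n)   = refl
  ⟦⟧-neg (-[1+ n ])  = sym (-‿involutive _)

  ⟦⟧-⊖ : ∀ m n → ⟦ m ⊖ n ⟧ℤ ≈ m Opt.× 1# - n Opt.× 1#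
  ⟦⟧-⊖ zero    zero    = sym (-‿inverseʳ 0#)
  ⟦⟧-⊖ zero    (suc n) = sym (+-identityˡ _)
  ⟦⟧-⊖ (suc m) zero    = sym (trans (+-congˡ -0≈0) (+-identityʳ _))
  ⟦⟧-⊖ (suc m) (suc n) = begin
    ⟦ suc m ⊖ suc n ⟧ℤ                           ≡⟨ ≡.cong ⟦_⟧ℤ (ℤ.[1+m]⊖[1+n]≡m⊖n m n) ⟩
    ⟦ m ⊖ n ⟧ℤ                                   ≈⟨ ⟦⟧-⊖ m n ⟩
    m′ - n′                                      ≈⟨ +-congʳ (sym (+-identityˡ _)) ⟩
    0# + m′ - n′                                 ≈⟨ +-congʳ (+-congʳ (sym (-‿inverseʳ 1#))) ⟩
    1# - 1# + m′ - n′                            ≈⟨ +-congʳ (+-assoc _ _ _) ⟩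
    1# + (- 1# + m′) - n′                        ≈⟨ +-congʳ (+-congˡ (+-comm _ _)) ⟩
    1# + (m′ - 1#) - n′                          ≈⟨ +-congʳ (sym (+-assoc _ _ _)) ⟩
    1# + m′ - 1# - n′                            ≈⟨ +-assoc _ _ _ ⟩
    1# + m′ + (- 1# - n′)                        ≈⟨ +-congˡ (⁻¹-∙-comm _ _) ⟩
    1# + m′ - (1# + n′)                          ≈⟨ +-cong (sym (Opt.1+× m 1#)) (-‿cong (sym (Opt.1+× n 1#))) ⟩
    suc m Opt.× 1# - suc n Opt.× 1#              ∎
    where
    open ≈-Reasoning
    m′ = m Opt.× 1#
    n′ = n Opt.× 1#

  ⟦⟧-+ : ∀ i j → ⟦ i ℤ.+ j ⟧ℤ ≈ ⟦ i ⟧ℤ + ⟦ j ⟧ℤ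
  ⟦⟧-+ (+ m)    (+ n)    = Opt.×-homo-+ 1# m n
  ⟦⟧-+ (+ m)    -[1+ n ] = ⟦⟧-⊖ m (suc n)
  ⟦⟧-+ -[1+ m ] (+ n)    = trans (⟦⟧-⊖ n (suc m)) (+-comm _ _)
  ⟦⟧-+ -[1+ m ] -[1+ n ] = trans (-‿cong (trans (reflexive (≡.cong (λ k → k Opt.× 1#) (≡.cong suc (≡.sym (ℕ.+-suc m n))))) (Opt.×-homo-+ 1# (suc m) (suc n)))) (sym (⁻¹-∙-comm _ _))

  ⟦⟧-*ˡ : ∀ m j → ⟦ + m ℤ.* j ⟧ℤ ≈ ⟦ + m ⟧ℤ * ⟦ j ⟧ℤ
  ⟦⟧-*ˡ m (+ n) = trans (reflexive (≡.cong ⟦_⟧ℤ (≡.sym (ℤ.pos-* m n)))) (Opt.×1-homo-* m n)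
  ⟦⟧-*ˡ m -[1+ n ] = begin
    ⟦ + m ℤ.* -[1+ n ] ⟧ℤ        ≡⟨ ≡.cong ⟦_⟧ℤ (≡.sym (ℤ.neg-distribʳ-* (+ m) (+ suc n))) ⟩
    ⟦ ℤ.- (+ m ℤ.* + suc n) ⟧ℤ   ≈⟨ ⟦⟧-neg (+ m ℤ.* + suc n) ⟩
    - ⟦ + m ℤ.* + suc n ⟧ℤ       ≈⟨ -‿cong (⟦⟧-*ˡ m (+ suc n)) ⟩
    - (⟦ + m ⟧ℤ * ⟦ + suc n ⟧ℤ)  ≈⟨ -‿distribʳ-* _ _ ⟩
    ⟦ + m ⟧ℤ * ⟦ -[1+ n ] ⟧ℤ     ∎
    where open ≈-Reasoning

  ⟦⟧-* : ∀ i j → ⟦ i ℤ.* j ⟧ℤ ≈ ⟦ i ⟧ℤ * ⟦ j ⟧ℤ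
  ⟦⟧-* (+ m)    j = ⟦⟧-*ˡ m j
  ⟦⟧-* -[1+ m ] j = begin
    ⟦ -[1+ m ] ℤ.* j ⟧ℤ          ≡⟨ ≡.cong ⟦_⟧ℤ (≡.sym (ℤ.neg-distribˡ-* (+ suc m) j)) ⟩
    ⟦ ℤ.- (+ suc m ℤ.* j) ⟧ℤ     ≈⟨ ⟦⟧-neg (+ suc m ℤ.* j) ⟩
    - ⟦ + suc m ℤ.* j ⟧ℤ         ≈⟨ -‿cong (⟦⟧-*ˡ (suc m) j) ⟩
    - (⟦ + suc m ⟧ℤ * ⟦ j ⟧ℤ)    ≈⟨ -‿distribˡ-* _ _ ⟩
    ⟦ -[1+ m ] ⟧ℤ * ⟦ j ⟧ℤ       ∎
    where open ≈-Reasoning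

  ℤ-morphism : ℤ-rawRing -Raw-AlmostCommutative⟶ fromCommutativeRing commutativeRing
  ℤ-morphism = record
    { ⟦_⟧ = ⟦_⟧ℤ ; +-homo = ⟦⟧-+ ; *-homo = ⟦⟧-* ; -‿homo = ⟦⟧-neg ; 0-homo = refl ; 1-homo = refl }

  ⟦⟧-≟ : ∀ i j → Maybe (⟦ i ⟧ℤ ≈ ⟦ j ⟧ℤ)
  ⟦⟧-≟ i j with i ℤ.≟ j
  ... | yes ≡.refl = just refl
  ... | no _       = nothing

  open import Algebra.Solver.Ring ℤ-rawRing (fromCommutativeRing commutativeRing) ℤ-morphism ⟦⟧-≟ using (solve; _:=_; _:+_; _:*_; _:-_; :-_; con)

  -- Ordered fields

  infix 4 _<_
  -- In a classical total order the negation is strictness, and a proof of `0# < x` can be applied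
  -- directly to refute `x ≤ 0#`.
  _<_ : ℝ → ℝ → Set
  x < y = ¬ (y ≤ x)

  <⇒≤ : ∀ {x y} → x < y → x ≤ y
  <⇒≤ {x} {y} x<y with total x y
  ... | inj₁ x≤y = x≤y
  ... | inj₂ y≤x = ⊥-elim (x<y y≤x)

  ≤⊎< : ∀ x y → x ≤ y ⊎ y < x
  ≤⊎< x y with em {x ≤ y}
  ... | yes x≤y = inj₁ x≤y
  ... | no  x≰y = inj₂ x≰y

  <-≤-trans : ∀ {x y z} → x < y → y ≤ z → x < z
  <-≤-trans x<y y≤z z≤x = x<y (≤-trans y≤z z≤x)

  ≤-<-trans : ∀ {x y z} → x ≤ y → y < z → x < z
  ≤-<-trans x≤y y<z z≤x = y<z (≤-trans z≤x x≤y)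

  >⇒≉ : ∀ {x y} → x < y → ¬ (y ≈ x)
  >⇒≉ x<y y≈x = x<y (≤-reflexive y≈x)

  +-monoʳ-≤ : ∀ {x y} z → x ≤ y → z + x ≤ z + y
  +-monoʳ-≤ {x} {y} z x≤y = begin
    z + x ≈⟨ +-comm z x ⟩
    x + z ≤⟨ +-monoˡ-≤ z x≤y ⟩
    y + z ≈⟨ +-comm y z ⟩
    z + y ∎
    where open ≤-Reasoning

  +-mono-≤ : ∀ {x y u v} → x ≤ y → u ≤ v → x + u ≤ y + v
  +-mono-≤ x≤y u≤v = ≤-trans (+-monoˡ-≤ _ x≤y) (+-monoʳ-≤ _ u≤v)

  +-nonNeg : ∀ {x y} → 0# ≤ x → 0# ≤ y → 0# ≤ x + y
  +-nonNeg 0≤x 0≤y = ≤-trans (≤-reflexive (sym (+-identityˡ 0#))) (+-mono-≤ 0≤x 0≤y)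

  x≤x+y : ∀ {x y} → 0# ≤ y → x ≤ x + y
  x≤x+y 0≤y = ≤-trans (≤-reflexive (sym (+-identityʳ _))) (+-monoʳ-≤ _ 0≤y)

  0≤y-x : ∀ {x y} → x ≤ y → 0# ≤ y - x
  0≤y-x {x} x≤y = ≤-trans (≤-reflexive (sym (-‿inverseʳ x))) (+-monoˡ-≤ (- x) x≤y)

  -- Reduces an inequality to the sign of an expression plus an identity that the ring solver can
  -- check.
  by-difference : ∀ {x y e} → 0# ≤ e → y - x ≈ e → x ≤ y
  by-difference {x} {y} {e} 0≤e y-x≈e = begin
    x           ≤⟨ x≤x+y 0≤e ⟩
    x + e       ≈⟨ +-congˡ (sym y-x≈e) ⟩
    x + (y - x) ≈⟨ solve 2 (λ x y → x :+ (y :- x) := y) refl x y ⟩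
    y           ∎
    where open ≤-Reasoning

  neg-mono-≤ : ∀ {x y} → x ≤ y → - y ≤ - x
  neg-mono-≤ {x} {y} x≤y = by-difference (0≤y-x x≤y) (solve 2 (λ x y → :- x :- :- y := y :- x) refl x y)

  *-monoˡ-≤ : ∀ {x y z} → 0# ≤ z → x ≤ y → x * z ≤ y * z
  *-monoˡ-≤ {x} {y} {z} 0≤z x≤y =
    by-difference (*-nonNeg (0≤y-x x≤y) 0≤z) (solve 3 (λ x y z → y :* z :- x :* z := (y :- x) :* z) refl x y z)

  *-monoʳ-≤ : ∀ {x y z} → 0# ≤ z → x ≤ y → z * x ≤ z * y
  *-monoʳ-≤ {x} {y} {z} 0≤z x≤y =
    by-difference (*-nonNeg 0≤z (0≤y-x x≤y)) (solve 3 (λ x y z → z :* y :- z :* x := z :* (y :- x)) refl x y z)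

  *-mono-≤ : ∀ {x y u v} → 0# ≤ y → 0# ≤ u → x ≤ y → u ≤ v → x * u ≤ y * v
  *-mono-≤ 0≤y 0≤u x≤y u≤v = ≤-trans (*-monoˡ-≤ 0≤u x≤y) (*-monoʳ-≤ 0≤y u≤v)

  0≤x² : ∀ x → 0# ≤ x * x
  0≤x² x with total 0# x
  ... | inj₁ 0≤x = *-nonNeg 0≤x 0≤x
  ... | inj₂ x≤0 = ≤-trans (*-nonNeg 0≤-x 0≤-x) (≤-reflexive (solve 1 (λ x → :- x :* :- x := x :* x) refl x))
    where
    0≤-x : 0# ≤ - x
    0≤-x = ≤-trans (≤-reflexive (sym -0≈0)) (neg-mono-≤ x≤0)

  0≤1 : 0# ≤ 1#
  0≤1 = ≤-trans (0≤x² 1#) (≤-reflexive (*-identityˡ 1#))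

  0<1 : 0# < 1#
  0<1 1≤0 = 0≉1 (≤-antisym 0≤1 1≤0)

  ⁻¹-inverseˡ : ∀ {x} → ¬ (x ≈ 0#) → x ⁻¹ * x ≈ 1#
  ⁻¹-inverseˡ x≉0 = trans (*-comm _ _) (⁻¹-inverseʳ x≉0)

  0<⁻¹ : ∀ {x} → 0# < x → 0# < x ⁻¹
  0<⁻¹ {x} 0<x x⁻¹≤0 = 0<1 (begin
    1#         ≈⟨ sym (⁻¹-inverseʳ (>⇒≉ 0<x)) ⟩
    x * x ⁻¹   ≤⟨ *-monoʳ-≤ (<⇒≤ 0<x) x⁻¹≤0 ⟩
    x * 0#     ≈⟨ zeroʳ x ⟩
    0#         ∎)
    where open ≤-Reasoning

  *-cancelʳ-≤ : ∀ {x y z} → 0# < z → x * z ≤ y * z → x ≤ y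
  *-cancelʳ-≤ {x} {y} {z} 0<z xz≤yz = begin
    x              ≈⟨ xzz⁻¹≈x x ⟨
    x * z * z ⁻¹   ≤⟨ *-monoˡ-≤ (<⇒≤ (0<⁻¹ 0<z)) xz≤yz ⟩
    y * z * z ⁻¹   ≈⟨ xzz⁻¹≈x y ⟩
    y              ∎
    where
    open ≤-Reasoning
    xzz⁻¹≈x : ∀ x → x * z * z ⁻¹ ≈ x
    xzz⁻¹≈x x = trans (*-assoc _ _ _) (trans (*-congˡ (⁻¹-inverseʳ (>⇒≉ 0<z))) (*-identityʳ x))

  *-cancelˡ-≤ : ∀ {x y z} → 0# < z → z * x ≤ z * y → x ≤ y
  *-cancelˡ-≤ 0<z zx≤zy = *-cancelʳ-≤ 0<z (≤-trans (≤-reflexive (*-comm _ _)) (≤-trans zx≤zy (≤-reflexive (*-comm _ _))))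

  *-positive : ∀ {x y} → 0# < x → 0# < y → 0# < x * y
  *-positive 0<x 0<y xy≤0 = 0<x (*-cancelʳ-≤ 0<y (≤-trans xy≤0 (≤-reflexive (sym (zeroˡ _)))))

  ^-positive : ∀ {x} n → 0# < x → 0# < x ^ n
  ^-positive zero    0<x = 0<1
  ^-positive (suc n) 0<x = *-positive 0<x (^-positive n 0<x)

  ^-nonNeg : ∀ {x} n → 0# ≤ x → 0# ≤ x ^ n
  ^-nonNeg zero    0≤x = 0≤1
  ^-nonNeg (suc n) 0≤x = *-nonNeg 0≤x (^-nonNeg n 0≤x)

  ^-monoˡ-≤ : ∀ {x y} n → 0# ≤ x → x ≤ y → x ^ n ≤ y ^ n
  ^-monoˡ-≤ zero    0≤x x≤y = ≤-refl
  ^-monoˡ-≤ (suc n) 0≤x x≤y = *-mono-≤ (≤-trans 0≤x x≤y) (^-nonNeg n 0≤x) x≤y (^-monoˡ-≤ n 0≤x x≤y)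

  1≤^ : ∀ {x} n → 1# ≤ x → 1# ≤ x ^ n
  1≤^ zero    1≤x = ≤-refl
  1≤^ {x} (suc n) 1≤x = ≤-trans (≤-reflexive (sym (*-identityˡ 1#)))
    (*-mono-≤ (≤-trans 0≤1 1≤x) 0≤1 1≤x (1≤^ n 1≤x))

  ^-cancelˡ-≤ : ∀ {x y} n → 0# ≤ y → x ^ suc n ≤ y ^ suc n → x ≤ y
  ^-cancelˡ-≤ {x} {y} n 0≤y xⁿ≤yⁿ with ≤⊎< x y
  ... | inj₁ x≤y = x≤y
  ... | inj₂ y<x = ⊥-elim (y<x (*-cancelʳ-≤ (^-positive n (≤-<-trans 0≤y y<x))
          (≤-trans xⁿ≤yⁿ (*-monoʳ-≤ 0≤y (^-monoˡ-≤ n 0≤y (<⇒≤ y<x))))))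

  ^-monoʳ-≤ : ∀ {x} m n → 1# ≤ x → m ℕ.≤ n → x ^ m ≤ x ^ n
  ^-monoʳ-≤ _       n       1≤x ℕ.z≤n       = 1≤^ n 1≤x
  ^-monoʳ-≤ (suc m) (suc n) 1≤x (ℕ.s≤s m≤n) = *-monoʳ-≤ (≤-trans 0≤1 1≤x) (^-monoʳ-≤ m n 1≤x m≤n)

  ^≤1 : ∀ {x} n → 0# ≤ x → x ≤ 1# → x ^ n ≤ 1#
  ^≤1 n 0≤x x≤1 = ≤-trans (^-monoˡ-≤ n 0≤x x≤1) (≤-reflexive (1^n≈1 n))
    where
    1^n≈1 : ∀ n → 1# ^ n ≈ 1#
    1^n≈1 zero    = refl
    1^n≈1 (suc n) = trans (*-identityˡ _) (1^n≈1 n)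

  ^-antitoneʳ-≤ : ∀ {x} m n → 0# ≤ x → x ≤ 1# → m ℕ.≤ n → x ^ n ≤ x ^ m
  ^-antitoneʳ-≤ _       n       0≤x x≤1 ℕ.z≤n       = ^≤1 n 0≤x x≤1
  ^-antitoneʳ-≤ (suc m) (suc n) 0≤x x≤1 (ℕ.s≤s m≤n) = *-monoʳ-≤ 0≤x (^-antitoneʳ-≤ m n 0≤x x≤1 m≤n)

  0≤fromℕ : ∀ n → 0# ≤ fromℕ n
  0≤fromℕ zero    = ≤-refl
  0≤fromℕ (suc n) = +-nonNeg 0≤1 (0≤fromℕ n)

  fromℕ-mono-≤ : ∀ {m n} → m ℕ.≤ n → fromℕ m ≤ fromℕ n
  fromℕ-mono-≤ {n = n} ℕ.z≤n = 0≤fromℕ n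
  fromℕ-mono-≤ (ℕ.s≤s m≤n) = +-monoʳ-≤ 1# (fromℕ-mono-≤ m≤n)

  0<fromℕ-suc : ∀ n → 0# < fromℕ (suc n)
  0<fromℕ-suc n = <-≤-trans 0<1 (x≤x+y (0≤fromℕ n))

  fromℕ-suc≰ : ∀ n → ¬ (fromℕ (suc n) ≤ fromℕ n)
  fromℕ-suc≰ n n+1≤n = 0<1 (begin
    1#                         ≈⟨ solve 2 (λ o n → o := o :+ n :- n) refl 1# (fromℕ n) ⟩
    1# + fromℕ n - fromℕ n     ≤⟨ +-monoˡ-≤ _ n+1≤n ⟩
    fromℕ n - fromℕ n          ≈⟨ -‿inverseʳ _ ⟩
    0#                         ∎)
    where open ≤-Reasoning

  fromℕ-cancel-≤ : ∀ m n → fromℕ m ≤ fromℕ n → m ℕ.≤ n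
  fromℕ-cancel-≤ m n m≤n with m ℕ.≤? n
  ... | yes p = p
  ... | no  p = ⊥-elim (fromℕ-suc≰ n (≤-trans (fromℕ-mono-≤ (ℕ.≰⇒> p)) m≤n))

  -- Otherwise the naturals are bounded and have a supremum `u`; but each natural is its successor
  -- minus 1, so `u - 1#` is an upper bound as well.
  archimedean : ∀ x → ∃[ n ] x ≤ fromℕ n
  archimedean x with em {∃[ n ] x ≤ fromℕ n}
  ... | yes p = p
  ... | no ¬p = ⊥-elim (u<u (proj₂ lub bound-1))
    where
    open ≤-Reasoning
    IsNat : ℝ → Set
    IsNat y = ∃[ n ] y ≈ fromℕ n
    x-bound : UpperBound IsNat x
    x-bound (n , y≈n) with ≤⊎< x (fromℕ n)
    ... | inj₁ x≤n = ⊥-elim (¬p (n , x≤n))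
    ... | inj₂ n<x = ≤-trans (≤-reflexive y≈n) (<⇒≤ n<x)
    supremum : ∃ (IsLub IsNat)
    supremum = complete IsNat (0# , 0 , refl) (x , λ {y} → x-bound {y})
    u = proj₁ supremum
    lub = proj₂ supremum
    bound-1 : UpperBound IsNat (u - 1#)
    bound-1 {y} (n , y≈n) = begin
      y                        ≈⟨ y≈n ⟩
      fromℕ n                  ≈⟨ solve 2 (λ o n → n := o :+ n :- o) refl 1# (fromℕ n) ⟩
      fromℕ (suc n) - 1#       ≤⟨ +-monoˡ-≤ _ (proj₁ lub (suc n , refl)) ⟩
      u - 1#                   ∎
    u<u : ¬ (u ≤ u - 1#)
    u<u u≤u-1 = 0<1 (begin
      1#             ≈⟨ solve 2 (λ o u → o := o :- u :+ u) refl 1# u ⟩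
      1# - u + u     ≤⟨ +-monoʳ-≤ _ u≤u-1 ⟩
      1# - u + (u - 1#) ≈⟨ solve 2 (λ o u → o :- u :+ (u :- o) := con (+ 0)) refl 1# u ⟩
      0#             ∎)

  -- Both bounds are weak, so at a positive integer two values of `m` qualify; `Growth` accordingly
  -- speaks of every such `m`.
  floor : ∀ {x} → 0# ≤ x → ∃[ m ] fromℕ m ≤ x × x ≤ fromℕ (suc m)
  floor {x} 0≤x = search (proj₁ (archimedean x)) (proj₂ (archimedean x))
    where
    search : ∀ n → x ≤ fromℕ n → ∃[ m ] fromℕ m ≤ x × x ≤ fromℕ (suc m)
    search zero    x≤0 = 0 , 0≤x , ≤-trans x≤0 (0≤fromℕ 1)
    search (suc n) x≤n+1 with total x (fromℕ n)
    ... | inj₁ x≤n = search n x≤n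
    ... | inj₂ n≤x = n , n≤x , x≤n+1

  bernoulli : ∀ {h} n → 0# ≤ h → 1# + fromℕ n * h ≤ (1# + h) ^ n
  bernoulli {h} zero 0≤h = ≤-reflexive (trans (+-congˡ (zeroˡ h)) (+-identityʳ 1#))
  bernoulli {h} (suc n) 0≤h = begin
    1# + (1# + fromℕ n) * h             ≤⟨ by-difference (*-nonNeg (0≤fromℕ n) (0≤x² h)) (solve 2 (λ n h →
       (con (+ 1) :+ h) :* (con (+ 1) :+ n :* h) :- (con (+ 1) :+ (con (+ 1) :+ n) :* h) := n :* (h :* h)) refl (fromℕ n) h) ⟩
    (1# + h) * (1# + fromℕ n * h)       ≤⟨ *-monoʳ-≤ (+-nonNeg 0≤1 0≤h) (bernoulli n 0≤h) ⟩
    (1# + h) * (1# + h) ^ n             ∎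
    where open ≤-Reasoning

  -- Otherwise (x / y) ^ k, which grows without bound by Bernoulli's inequality, would be at most C.
  ≤-from-powers : ∀ {x y} C → 0# ≤ y → (∀ k → x ^ suc k ≤ C * y ^ suc k) → x ≤ y
  ≤-from-powers {x} {y} C 0≤y xᵏ≤Cyᵏ with ≤⊎< x y | ≤⊎< y 0#
  ... | inj₁ x≤y | _ = x≤y
  ... | inj₂ y<x | inj₁ y≤0 = begin
    x               ≈⟨ sym (*-identityʳ x) ⟩
    x * 1#          ≤⟨ xᵏ≤Cyᵏ 0 ⟩
    C * (y * 1#)    ≈⟨ *-congˡ (*-congʳ (≤-antisym y≤0 0≤y)) ⟩
    C * (0# * 1#)   ≈⟨ trans (*-congˡ (zeroˡ 1#)) (zeroʳ C) ⟩
    0#              ≤⟨ 0≤y ⟩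
    y               ∎
    where open ≤-Reasoning
  ... | inj₂ y<x | inj₂ 0<y = ⊥-elim (0<1 contradiction)
    where
    open ≤-Reasoning
    h = (x - y) * y ⁻¹
    0<h : 0# < h
    0<h = *-positive (λ x-y≤0 → y<x (by-difference (≤-trans (≤-reflexive (sym -0≈0)) (neg-mono-≤ x-y≤0))
            (solve 2 (λ x y → y :- x := :- (x :- y)) refl x y))) (0<⁻¹ 0<y)
    ratio : (1# + h) * y ≈ x
    ratio = trans (solve 3 (λ x y i → (con (+ 1) :+ (x :- y) :* i) :* y := y :+ (x :- y) :* (y :* i)) refl x y (y ⁻¹))
      (trans (+-congˡ (*-congˡ (⁻¹-inverseʳ (>⇒≉ 0<y)))) (solve 2 (λ x y → y :+ (x :- y) :* con (+ 1) := x) refl x y))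
    bounded : ∀ k → (1# + h) ^ suc k ≤ C
    bounded k = *-cancelʳ-≤ (^-positive (suc k) 0<y) (begin
      (1# + h) ^ suc k * y ^ suc k  ≈⟨ sym (^-distrib-* (1# + h) y (suc k)) ⟩
      ((1# + h) * y) ^ suc k        ≈⟨ ^-congˡ (suc k) ratio ⟩
      x ^ suc k                     ≤⟨ xᵏ≤Cyᵏ k ⟩
      C * y ^ suc k                 ∎)
    -- With `n ≥ C / h`, Bernoulli's inequality at `suc n` gives 1 + (n + 1) h ≤ C, whereas already
    -- n h ≥ C.
    n = proj₁ (archimedean (C * h ⁻¹))
    contradiction : 1# ≤ 0#
    contradiction = begin
      1#                             ≤⟨ by-difference (<⇒≤ 0<h) (solve 2 (λ n h → con (+ 1) :+ (con (+ 1) :+ n) :* h :- n :* h :- con (+ 1) := h) refl (fromℕ n) h) ⟩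
      1# + fromℕ (suc n) * h - fromℕ n * h   ≤⟨ +-monoˡ-≤ _ (≤-trans (bernoulli (suc n) (<⇒≤ 0<h)) (bounded n)) ⟩
      C - fromℕ n * h                ≤⟨ +-monoʳ-≤ C (neg-mono-≤ (*-monoˡ-≤ (<⇒≤ 0<h) (proj₂ (archimedean (C * h ⁻¹))))) ⟩
      C - C * h ⁻¹ * h               ≈⟨ +-congˡ (-‿cong (trans (*-assoc _ _ _) (trans (*-congˡ (⁻¹-inverseˡ (>⇒≉ 0<h))) (*-identityʳ C)))) ⟩
      C - C                          ≈⟨ -‿inverseʳ C ⟩
      0#                             ∎

  -- Real powers

  -- A quantitative form of continuity at 0: for h in [0, 1] the power is at most 1 + c h, where c
  -- becomes 1 + 2c when the exponent grows by one. Then h = 1 / (1 + c) works.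
  near-1 : ∀ k → ∃[ h ] 0# < h × (1# + h) ^ k ≤ 1# + 1#
  near-1 k = h , 0<h , ≤-trans (proj₂ (proj₂ (linear k)) h (<⇒≤ 0<h) h≤1) (+-monoʳ-≤ 1# ch≤1)
    where
    open ≤-Reasoning
    linear : ∀ k → ∃[ c ] 0# ≤ c × (∀ h → 0# ≤ h → h ≤ 1# → (1# + h) ^ k ≤ 1# + c * h)
    linear zero    = 0# , ≤-refl , λ h _ _ → x≤x+y (≤-reflexive (sym (zeroˡ h)))
    linear (suc k) with linear k
    ... | c , 0≤c , bound = 1# + c + c , +-nonNeg (+-nonNeg 0≤1 0≤c) 0≤c , λ h 0≤h h≤1 → begin
      (1# + h) * (1# + h) ^ k   ≤⟨ *-monoʳ-≤ (+-nonNeg 0≤1 0≤h) (bound h 0≤h h≤1) ⟩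
      (1# + h) * (1# + c * h)   ≤⟨ by-difference (*-nonNeg (*-nonNeg 0≤c 0≤h) (0≤y-x h≤1)) (solve 2 (λ c h →
          con (+ 1) :+ (con (+ 1) :+ c :+ c) :* h :- (con (+ 1) :+ h) :* (con (+ 1) :+ c :* h) := c :* h :* (con (+ 1) :- h)) refl c h) ⟩
      1# + (1# + c + c) * h     ∎
    c = proj₁ (linear k)
    0≤c = proj₁ (proj₂ (linear k))
    0<1+c : 0# < 1# + c
    0<1+c = <-≤-trans 0<1 (x≤x+y 0≤c)
    h = (1# + c) ⁻¹
    0<h : 0# < h
    0<h = 0<⁻¹ 0<1+c
    h≤1 : h ≤ 1#
    h≤1 = *-cancelˡ-≤ 0<1+c (≤-trans (≤-reflexive (⁻¹-inverseʳ (>⇒≉ 0<1+c)))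
      (≤-trans (x≤x+y 0≤c) (≤-reflexive (sym (*-identityʳ _)))))
    ch≤1 : c * h ≤ 1#
    ch≤1 = ≤-trans (*-monoˡ-≤ (<⇒≤ 0<h) (≤-trans (x≤x+y 0≤1) (≤-reflexive (+-comm c 1#))))
      (≤-reflexive (⁻¹-inverseʳ (>⇒≉ 0<1+c)))

  sup-isLub : ∀ P → Satisfiable P → Satisfiable (UpperBound P) → IsLub P (sup P)
  sup-isLub P inhabited bounded with em {∃ (IsLub P)}
  ... | yes lub = proj₂ lub
  ... | no ¬lub = ⊥-elim (¬lub (complete P inhabited bounded))

  0∈BelowPower : ∀ {x a} → 0# ≤ x → 0# ≤ a → BelowPower x a 0#
  0∈BelowPower {x} {a} 0≤x 0≤a with total 1# x
  ... | inj₁ 1≤x = ≤-refl , 0 , 0 , inj₁ (1≤x , *-nonNeg (0≤fromℕ 1) 0≤a) , ≤-trans (≤-reflexive (zeroˡ 1#)) 0≤1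
  ... | inj₂ x≤1 with archimedean (fromℕ 1 * a)
  ... | m , a≤m = ≤-refl , m , 0 , inj₂ (x≤1 , a≤m) , ≤-trans (≤-reflexive (zeroˡ 1#)) (^-nonNeg m 0≤x)

  -- The bound is `1#` if `x ≤ 1#`, and `x ^ M` with an integer `M ≥ a` if `1# ≤ x`; both are
  -- compared with `t` after taking powers with exponent `suc n`.
  BelowPower-bounded : ∀ {x a} → 0# ≤ x → Satisfiable (UpperBound (BelowPower x a))
  BelowPower-bounded {x} {a} 0≤x with total 1# x
  ... | inj₂ x≤1 = 1# , λ (0≤t , m , n , _ , tⁿ≤xᵐ) → ^-cancelˡ-≤ n 0≤1
        (≤-trans tⁿ≤xᵐ (≤-trans (^≤1 m 0≤x x≤1) (1≤^ (suc n) ≤-refl)))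
  ... | inj₁ 1≤x with archimedean a
  ... | M , a≤M = x ^ M , bound
    where
    open ≤-Reasoning
    bound : UpperBound (BelowPower x a) (x ^ M)
    bound {t} (0≤t , m , n , inj₁ (_ , m≤na) , tⁿ≤xᵐ) = ^-cancelˡ-≤ n (^-nonNeg M 0≤x) (begin
      t ^ suc n         ≤⟨ tⁿ≤xᵐ ⟩
      x ^ m             ≤⟨ ^-monoʳ-≤ m (M ℕ.* suc n) 1≤x (fromℕ-cancel-≤ m (M ℕ.* suc n) (≤-trans m≤na (≤-trans (*-monoʳ-≤ (0≤fromℕ (suc n)) a≤M) (≤-reflexive (trans (*-comm _ _) (sym (×1-homo-* M (suc n)))))))) ⟩
      x ^ (M ℕ.* suc n) ≈⟨ sym (^-assocʳ x M (suc n)) ⟩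
      (x ^ M) ^ suc n   ∎)
    bound {t} (0≤t , m , n , inj₂ (x≤1 , _) , tⁿ≤xᵐ) = ≤-trans
      (^-cancelˡ-≤ n 0≤1 (≤-trans tⁿ≤xᵐ (≤-trans (^≤1 m 0≤x x≤1) (1≤^ (suc n) ≤-refl)))) (1≤^ M 1≤x)

  ^ᴿ-isLub : ∀ {x a} → 0# ≤ x → 0# ≤ a → IsLub (BelowPower x a) (x ^ᴿ a)
  ^ᴿ-isLub 0≤x 0≤a = sup-isLub _ (0# , 0∈BelowPower 0≤x 0≤a) (BelowPower-bounded 0≤x)

  ^ᴿ-nonNeg : ∀ {x a} → 0# ≤ x → 0# ≤ a → 0# ≤ x ^ᴿ a
  ^ᴿ-nonNeg 0≤x 0≤a = proj₁ (^ᴿ-isLub 0≤x 0≤a) (0∈BelowPower 0≤x 0≤a)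

  ^ᴿ-positive : ∀ {x a} → 0# < x → 0# ≤ a → 0# < x ^ᴿ a
  ^ᴿ-positive {x} {a} 0<x 0≤a with total 1# x
  ... | inj₁ 1≤x = <-≤-trans 0<1 (proj₁ (^ᴿ-isLub (<⇒≤ 0<x) 0≤a)
        (0≤1 , 0 , 0 , inj₁ (1≤x , *-nonNeg (0≤fromℕ 1) 0≤a) , ≤-reflexive (*-identityˡ 1#)))
  ... | inj₂ x≤1 with archimedean (fromℕ 1 * a)
  ... | m , a≤m = <-≤-trans (^-positive m 0<x) (proj₁ (^ᴿ-isLub (<⇒≤ 0<x) 0≤a)
        (<⇒≤ (^-positive m 0<x) , m , 0 , inj₂ (x≤1 , a≤m) , ≤-reflexive (*-identityʳ _)))

  ^ᴿ-zero : ∀ {x a} → 0# ≤ x → x ≤ 0# → 0# < a → x ^ᴿ a ≤ 0#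
  ^ᴿ-zero {x} {a} 0≤x x≤0 0<a = proj₂ (^ᴿ-isLub 0≤x (<⇒≤ 0<a)) bound
    where
    bound : UpperBound (BelowPower x a) 0#
    bound (0≤t , m , n , inj₁ (1≤x , _) , _) = ⊥-elim (0<1 (≤-trans 1≤x x≤0))
    -- The exponent 0 would admit every `t ≤ 1#`, since `0# ^ 0` is `1#`. It is excluded because it
    -- would have to be at least `fromℕ (suc n) * a`, which is positive.
    bound (0≤t , zero , n , inj₂ (_ , na≤0) , _) = ⊥-elim (*-positive (0<fromℕ-suc n) 0<a na≤0)
    bound (0≤t , suc m , n , inj₂ _ , tⁿ≤xᵐ) = ^-cancelˡ-≤ n ≤-refl
      (≤-trans tⁿ≤xᵐ (≤-trans (*-monoˡ-≤ (^-nonNeg m 0≤x) x≤0) (≤-reflexive (trans (zeroˡ _) (sym (zeroˡ _))))))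

  ^ᴿ≤base : ∀ {x a} → 0# ≤ x → x ≤ 1# → 1# ≤ a → x ^ᴿ a ≤ x
  ^ᴿ≤base {x} {a} 0≤x x≤1 1≤a = proj₂ (^ᴿ-isLub 0≤x (≤-trans 0≤1 1≤a)) bound
    where
    bound : UpperBound (BelowPower x a) x
    bound (0≤t , m , n , inj₁ (1≤x , _) , tⁿ≤xᵐ) = ≤-trans
      (^-cancelˡ-≤ n 0≤1 (≤-trans tⁿ≤xᵐ (≤-trans (^≤1 m 0≤x x≤1) (1≤^ (suc n) ≤-refl)))) 1≤x
    bound (0≤t , m , n , inj₂ (_ , na≤m) , tⁿ≤xᵐ) = ^-cancelˡ-≤ n 0≤x (≤-trans tⁿ≤xᵐ
      (^-antitoneʳ-≤ (suc n) m 0≤x x≤1 (fromℕ-cancel-≤ (suc n) m (≤-trans (≤-trans (≤-reflexive (sym (*-identityʳ _))) (*-monoʳ-≤ (0≤fromℕ (suc n)) 1≤a)) na≤m))))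

  base≤^ᴿ : ∀ {x a} → 1# ≤ x → 1# ≤ a → x ≤ x ^ᴿ a
  base≤^ᴿ {x} {a} 1≤x 1≤a = proj₁ (^ᴿ-isLub 0≤x (≤-trans 0≤1 1≤a))
    (0≤x , 1 , 0 , inj₁ (1≤x , ≤-trans (≤-reflexive (sym (*-identityʳ _))) (*-monoʳ-≤ (0≤fromℕ 1) 1≤a)) , ≤-refl)
    where
    0≤x : 0# ≤ x
    0≤x = ≤-trans 0≤1 1≤x

  -- Then x ^ m and x ^ n differ by at most a factor C ^ ∣ m - n ∣.
  Dominates : ℝ → ℝ → Set
  Dominates C x = 1# ≤ C × x ≤ C × 1# ≤ C * x

  dominator : ∀ {x} → 0# < x → ∃[ C ] Dominates C x
  dominator {x} 0<x with total 1# x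
  ... | inj₁ 1≤x = x , 1≤x , ≤-refl , ≤-trans 1≤x (≤-trans (≤-reflexive (sym (*-identityˡ x))) (*-monoˡ-≤ (<⇒≤ 0<x) 1≤x))
  ... | inj₂ x≤1 = x ⁻¹ , 1≤x⁻¹ , ≤-trans x≤1 1≤x⁻¹ , ≤-reflexive (sym (⁻¹-inverseˡ (>⇒≉ 0<x)))
    where
    1≤x⁻¹ : 1# ≤ x ⁻¹
    1≤x⁻¹ = *-cancelʳ-≤ 0<x (≤-trans (≤-reflexive (*-identityˡ x)) (≤-trans x≤1 (≤-reflexive (sym (⁻¹-inverseˡ (>⇒≉ 0<x))))))

  nearby-powers : ∀ {C x} N {m n} → 0# < x → Dominates C x → m ℕ.≤ n → n ℕ.≤ m ℕ.+ N →
                  x ^ n ≤ C ^ N * x ^ m × x ^ m ≤ C ^ N * x ^ n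
  nearby-powers {C} {x} N {m} {n} 0<x (1≤C , x≤C , 1≤Cx) m≤n n≤m+N =
    ≤-trans (≤-reflexive xⁿ) (*-monoˡ-≤ 0≤xᵐ (≤-trans (^-monoˡ-≤ i 0≤x x≤C) Cⁱ≤Cᴺ)) ,
    (begin
      x ^ m                       ≤⟨ ≤-trans (≤-reflexive (sym (*-identityˡ _))) (*-monoˡ-≤ 0≤xᵐ (1≤^ i 1≤Cx)) ⟩
      (C * x) ^ i * x ^ m         ≈⟨ *-congʳ (^-distrib-* C x i) ⟩
      C ^ i * x ^ i * x ^ m       ≈⟨ *-assoc _ _ _ ⟩
      C ^ i * (x ^ i * x ^ m)     ≈⟨ *-congˡ (sym xⁿ) ⟩
      C ^ i * x ^ n               ≤⟨ *-monoˡ-≤ (^-nonNeg n 0≤x) Cⁱ≤Cᴺ ⟩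
      C ^ N * x ^ n               ∎)
    where
    open ≤-Reasoning
    i = n ℕ.∸ m
    0≤x = <⇒≤ 0<x
    0≤xᵐ = ^-nonNeg m 0≤x
    xⁿ : x ^ n ≈ x ^ i * x ^ m
    xⁿ = trans (^-congʳ x (≡.sym (ℕ.m∸n+n≡m m≤n))) (^-homo-* x i m)
    Cⁱ≤Cᴺ : C ^ i ≤ C ^ N
    Cⁱ≤Cᴺ = ^-monoʳ-≤ i N 1≤C (ℕ.≤-trans (ℕ.∸-monoˡ-≤ m n≤m+N) (ℕ.≤-reflexive (ℕ.m+n∸m≡n m N)))

  -- y ^ k ≍ x ^ ⌊ k a ⌋ uniformly in k; for x > 0 this characterises y = x ^ᴿ a without
  -- the case distinction on x ≥ 1.
  Growth : ℝ → ℝ → ℝ → Set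
  Growth x a y = ∃[ C ] 0# ≤ C × (∀ k m → fromℕ m ≤ fromℕ k * a → fromℕ k * a ≤ fromℕ (suc m) →
                  y ^ k ≤ C * x ^ m × x ^ m ≤ C * y ^ k)

  -- After raising to the power `suc n`, exponents of `x` are compared as integers. For `x ≤ 1#`
  -- they are ordered as needed. For `1# ≤ x` only m′ k ≤ (m + 1) (n + 1) is available, and the
  -- surplus factor `x` inside the power is absorbed by `K`.
  BelowPower-upper : ∀ {K x a t} k m → 0# ≤ x → Dominates K x → fromℕ m ≤ fromℕ k * a → fromℕ k * a ≤ fromℕ (suc m) →
                     BelowPower x a t → t ^ k ≤ K * x ^ m
  BelowPower-upper {K} {x} {a} {t} k m 0≤x (1≤K , x≤K , _) m≤ka ka≤m+1 (0≤t , m′ , n , side , tⁿ≤xᵐ′) =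
    ^-cancelˡ-≤ n (*-nonNeg (≤-trans 0≤1 1≤K) (^-nonNeg m 0≤x)) (begin
      (t ^ k) ^ suc n         ≈⟨ trans (^-assocʳ t k (suc n)) (trans (^-congʳ t (ℕ.*-comm k (suc n))) (sym (^-assocʳ t (suc n) k))) ⟩
      (t ^ suc n) ^ k         ≤⟨ ^-monoˡ-≤ k (^-nonNeg (suc n) 0≤t) tⁿ≤xᵐ′ ⟩
      (x ^ m′) ^ k            ≈⟨ ^-assocʳ x m′ k ⟩
      x ^ (m′ ℕ.* k)          ≤⟨ compare side ⟩
      (K * x ^ m) ^ suc n     ∎)
    where
    open ≤-Reasoning
    swap : fromℕ k * (fromℕ (suc n) * a) ≈ fromℕ (suc n) * (fromℕ k * a)
    swap = solve 3 (λ k n a → k :* (n :* a) := n :* (k :* a)) refl (fromℕ k) (fromℕ (suc n)) a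
    compare : (1# ≤ x × fromℕ m′ ≤ fromℕ (suc n) * a) ⊎ (x ≤ 1# × fromℕ (suc n) * a ≤ fromℕ m′) →
              x ^ (m′ ℕ.* k) ≤ (K * x ^ m) ^ suc n
    compare (inj₁ (1≤x , m′≤na)) = begin
      x ^ (m′ ℕ.* k)        ≤⟨ ^-monoʳ-≤ (m′ ℕ.* k) (suc m ℕ.* suc n) 1≤x (fromℕ-cancel-≤ (m′ ℕ.* k) (suc m ℕ.* suc n) (begin
        fromℕ (m′ ℕ.* k)                ≈⟨ trans (×1-homo-* m′ k) (*-comm _ _) ⟩
        fromℕ k * fromℕ m′              ≤⟨ *-monoʳ-≤ (0≤fromℕ k) m′≤na ⟩
        fromℕ k * (fromℕ (suc n) * a)   ≈⟨ swap ⟩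
        fromℕ (suc n) * (fromℕ k * a)   ≤⟨ *-monoʳ-≤ (0≤fromℕ (suc n)) ka≤m+1 ⟩
        fromℕ (suc n) * fromℕ (suc m)   ≈⟨ trans (*-comm _ _) (sym (×1-homo-* (suc m) (suc n))) ⟩
        fromℕ (suc m ℕ.* suc n)         ∎)) ⟩
      x ^ (suc m ℕ.* suc n) ≈⟨ sym (^-assocʳ x (suc m) (suc n)) ⟩
      (x ^ suc m) ^ suc n   ≤⟨ ^-monoˡ-≤ (suc n) (^-nonNeg (suc m) 0≤x) (*-monoˡ-≤ (^-nonNeg m 0≤x) x≤K) ⟩
      (K * x ^ m) ^ suc n   ∎
    compare (inj₂ (x≤1 , na≤m′)) = begin
      x ^ (m′ ℕ.* k)        ≤⟨ ^-antitoneʳ-≤ (m ℕ.* suc n) (m′ ℕ.* k) 0≤x x≤1 (fromℕ-cancel-≤ (m ℕ.* suc n) (m′ ℕ.* k) (begin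
        fromℕ (m ℕ.* suc n)             ≈⟨ trans (×1-homo-* m (suc n)) (*-comm _ _) ⟩
        fromℕ (suc n) * fromℕ m         ≤⟨ *-monoʳ-≤ (0≤fromℕ (suc n)) m≤ka ⟩
        fromℕ (suc n) * (fromℕ k * a)   ≈⟨ sym swap ⟩
        fromℕ k * (fromℕ (suc n) * a)   ≤⟨ *-monoʳ-≤ (0≤fromℕ k) na≤m′ ⟩
        fromℕ k * fromℕ m′              ≈⟨ trans (*-comm _ _) (sym (×1-homo-* m′ k)) ⟩
        fromℕ (m′ ℕ.* k)                ∎)) ⟩
      x ^ (m ℕ.* suc n)     ≈⟨ sym (^-assocʳ x m (suc n)) ⟩
      (x ^ m) ^ suc n       ≤⟨ ^-monoˡ-≤ (suc n) (^-nonNeg m 0≤x) (≤-trans (≤-reflexive (sym (*-identityˡ _))) (*-monoˡ-≤ (^-nonNeg m 0≤x) 1≤K)) ⟩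
      (K * x ^ m) ^ suc n   ∎

  -- The witness exponent is m / (k + 1) for `1# ≤ x` but (m + 1) / (k + 1) for `x < 1#`, where `a`
  -- must be approximated from above. The additional factor `x` in the second case is paid for by
  -- `1# ≤ K * x`.
  BelowPower-lower : ∀ {K x a t} k m → 0# ≤ x → Dominates K x → 0# ≤ t →
                     fromℕ m ≤ fromℕ (suc k) * a → fromℕ (suc k) * a ≤ fromℕ (suc m) →
                     K * t ^ suc k ≤ x ^ m → BelowPower x a t
  BelowPower-lower {K} {x} {a} {t} k m 0≤x (1≤K , _ , 1≤Kx) 0≤t m≤ka ka≤m+1 Ktᵏ≤xᵐ with ≤⊎< 1# x
  ... | inj₁ 1≤x = 0≤t , m , k , inj₁ (1≤x , m≤ka) ,
        ≤-trans (≤-trans (≤-reflexive (sym (*-identityˡ _))) (*-monoˡ-≤ (^-nonNeg (suc k) 0≤t) 1≤K)) Ktᵏ≤xᵐ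
  ... | inj₂ x<1 = 0≤t , suc m , k , inj₂ (<⇒≤ x<1 , ka≤m+1) , (begin
        t ^ suc k            ≤⟨ ≤-trans (≤-reflexive (sym (*-identityˡ _))) (*-monoˡ-≤ (^-nonNeg (suc k) 0≤t) 1≤Kx) ⟩
        K * x * t ^ suc k    ≈⟨ solve 3 (λ K x t → K :* x :* t := x :* (K :* t)) refl K x (t ^ suc k) ⟩
        x * (K * t ^ suc k)  ≤⟨ *-monoʳ-≤ 0≤x Ktᵏ≤xᵐ ⟩
        x * x ^ m            ∎)
    where open ≤-Reasoning

  enlarged≰ : ∀ {h y} → 0# < h → 0# < y → ¬ ((1# + h) * y ≤ y)
  enlarged≰ {h} {y} 0<h 0<y y+hy≤y = *-positive 0<h 0<y (begin
    h * y                  ≈⟨ solve 2 (λ h y → h :* y := (con (+ 1) :+ h) :* y :- y) refl h y ⟩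
    (1# + h) * y - y       ≤⟨ +-monoˡ-≤ _ y+hy≤y ⟩
    y - y                  ≈⟨ -‿inverseʳ y ⟩
    0#                     ∎)
    where open ≤-Reasoning

  enlarged-power : ∀ {h t c} k → 0# ≤ t → (1# + h) ^ k ≤ c → ((1# + h) * t) ^ k ≤ c * t ^ k
  enlarged-power k 0≤t small = ≤-trans (≤-reflexive (^-distrib-* _ _ k)) (*-monoˡ-≤ (^-nonNeg k 0≤t) small)

  -- Let (1 + h) ^ suc k ≤ 2.  If the first bound failed, then x ^ᴿ a / (1 + h) would still be an upper
  -- bound of BelowPower x a; if the second failed, then (1 + h) * x ^ᴿ a would be an element of it.
  ^ᴿ-growth-suc : ∀ {K x a} k m → 0# < x → 0# ≤ a → Dominates K x →
                  fromℕ m ≤ fromℕ (suc k) * a → fromℕ (suc k) * a ≤ fromℕ (suc m) →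
                  (x ^ᴿ a) ^ suc k ≤ (1# + 1#) * K * x ^ m × x ^ m ≤ (1# + 1#) * K * (x ^ᴿ a) ^ suc k
  ^ᴿ-growth-suc {K} {x} {a} k m 0<x 0≤a dom@(1≤K , _) m≤ka ka≤m+1 =
    bounds (x ^ᴿ a) (^ᴿ-positive 0<x 0≤a) (^ᴿ-isLub (<⇒≤ 0<x) 0≤a) (near-1 (suc k))
    where
    open ≤-Reasoning
    2# = 1# + 1#
    0≤2 = +-nonNeg 0≤1 0≤1
    0≤K = ≤-trans 0≤1 1≤K
    bounds : ∀ y → 0# < y → IsLub (BelowPower x a) y → ∃[ h ] 0# < h × (1# + h) ^ suc k ≤ 2# →
             y ^ suc k ≤ 2# * K * x ^ m × x ^ m ≤ 2# * K * y ^ suc k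
    bounds y 0<y (bound , least) (h , 0<h , small) = left , right
      where
      0<1+h : 0# < 1# + h
      0<1+h = <-≤-trans 0<1 (x≤x+y (<⇒≤ 0<h))
      cancel : ∀ y → (1# + h) * ((1# + h) ⁻¹ * y) ≈ y
      cancel y = trans (sym (*-assoc _ _ _)) (trans (*-congʳ (⁻¹-inverseʳ (>⇒≉ 0<1+h))) (*-identityˡ y))
      smaller-bound : 2# * K * x ^ m < y ^ suc k → UpperBound (BelowPower x a) ((1# + h) ⁻¹ * y)
      smaller-bound Cxᵐ<yᵏ {t} t∈ = *-cancelˡ-≤ 0<1+h (≤-trans (^-cancelˡ-≤ k (<⇒≤ 0<y) (begin
        ((1# + h) * t) ^ suc k     ≤⟨ enlarged-power (suc k) (proj₁ t∈) small ⟩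
        2# * t ^ suc k             ≤⟨ *-monoʳ-≤ 0≤2 (BelowPower-upper (suc k) m (<⇒≤ 0<x) dom m≤ka ka≤m+1 t∈) ⟩
        2# * (K * x ^ m)           ≈⟨ sym (*-assoc _ _ _) ⟩
        2# * K * x ^ m             ≤⟨ <⇒≤ Cxᵐ<yᵏ ⟩
        y ^ suc k                  ∎)) (≤-reflexive (sym (cancel y))))
      left : y ^ suc k ≤ 2# * K * x ^ m
      left with ≤⊎< (y ^ suc k) (2# * K * x ^ m)
      ... | inj₁ p = p
      ... | inj₂ Cxᵐ<yᵏ = ⊥-elim (enlarged≰ 0<h 0<y (≤-trans
            (*-monoʳ-≤ (<⇒≤ 0<1+h) (least (smaller-bound Cxᵐ<yᵏ))) (≤-reflexive (cancel y))))
      right : x ^ m ≤ 2# * K * y ^ suc k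
      right with ≤⊎< (x ^ m) (2# * K * y ^ suc k)
      ... | inj₁ p = p
      ... | inj₂ Cyᵏ<xᵐ = ⊥-elim (enlarged≰ 0<h 0<y (bound
            (BelowPower-lower k m (<⇒≤ 0<x) dom (*-nonNeg (<⇒≤ 0<1+h) (<⇒≤ 0<y)) m≤ka ka≤m+1 (begin
              K * ((1# + h) * y) ^ suc k   ≤⟨ *-monoʳ-≤ 0≤K (enlarged-power (suc k) (<⇒≤ 0<y) small) ⟩
              K * (2# * y ^ suc k)         ≈⟨ solve 3 (λ K t y → K :* (t :* y) := t :* K :* y) refl K 2# (y ^ suc k) ⟩
              2# * K * y ^ suc k           ≤⟨ <⇒≤ Cyᵏ<xᵐ ⟩
              x ^ m                        ∎))))

  ^ᴿ-growth : ∀ {x a} → 0# < x → 0# ≤ a → Growth x a (x ^ᴿ a)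
  ^ᴿ-growth {x} {a} 0<x 0≤a with dominator 0<x
  ... | K , dom@(1≤K , _) = C , ≤-trans 0≤1 1≤C , growth
    where
    C = (1# + 1#) * K
    1≤C : 1# ≤ C
    1≤C = ≤-trans (≤-reflexive (sym (*-identityˡ 1#))) (*-mono-≤ (+-nonNeg 0≤1 0≤1) 0≤1 (x≤x+y 0≤1) 1≤K)
    1≤C*1 : 1# ≤ C * 1#
    1≤C*1 = ≤-trans 1≤C (≤-reflexive (sym (*-identityʳ C)))
    growth : ∀ k m → fromℕ m ≤ fromℕ k * a → fromℕ k * a ≤ fromℕ (suc m) →
             (x ^ᴿ a) ^ k ≤ C * x ^ m × x ^ m ≤ C * (x ^ᴿ a) ^ k
    growth zero    zero    _   _ = 1≤C*1 , 1≤C*1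
    growth zero    (suc m) m≤0 _ = ⊥-elim (0<fromℕ-suc m (≤-trans m≤0 (≤-reflexive (zeroˡ a))))
    growth (suc k) m             = ^ᴿ-growth-suc k m 0<x 0≤a dom

  -- Both growth rates pass through the same exponent `m`, so y ^ k ≤ C C′ y′ ^ k for every positive
  -- k, and `≤-from-powers` removes the constant. Monotonicity and uniqueness of real powers both
  -- rest on this.
  growth-≤ : ∀ {x x′ a y y′} → 0# ≤ x → 0# ≤ a → 0# ≤ y′ → x ≤ x′ → Growth x a y → Growth x′ a y′ → y ≤ y′
  growth-≤ {x} {x′} {a} {y} {y′} 0≤x 0≤a 0≤y′ x≤x′ (C , 0≤C , growth) (C′ , _ , growth′) =
    ≤-from-powers (C * C′) 0≤y′ bound
    where
    open ≤-Reasoning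
    bound : ∀ k → y ^ suc k ≤ C * C′ * y′ ^ suc k
    bound k with floor (*-nonNeg (0≤fromℕ (suc k)) 0≤a)
    ... | m , m≤ka , ka≤m+1 = begin
      y ^ suc k              ≤⟨ proj₁ (growth (suc k) m m≤ka ka≤m+1) ⟩
      C * x ^ m              ≤⟨ *-monoʳ-≤ 0≤C (^-monoˡ-≤ m 0≤x x≤x′) ⟩
      C * x′ ^ m             ≤⟨ *-monoʳ-≤ 0≤C (proj₂ (growth′ (suc k) m m≤ka ka≤m+1)) ⟩
      C * (C′ * y′ ^ suc k)  ≈⟨ sym (*-assoc _ _ _) ⟩
      C * C′ * y′ ^ suc k    ∎

  growth-* : ∀ {x x′ a y y′} → 0# ≤ x → 0# ≤ x′ → 0# ≤ y → 0# ≤ y′ →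
             Growth x a y → Growth x′ a y′ → Growth (x * x′) a (y * y′)
  growth-* {x} {x′} {a} {y} {y′} 0≤x 0≤x′ 0≤y 0≤y′ (C , 0≤C , growth) (C′ , 0≤C′ , growth′) =
    C * C′ , *-nonNeg 0≤C 0≤C′ , λ k m m≤ka ka≤m+1 →
      multiply k m y y′ x x′ 0≤y′ 0≤x (proj₁ (growth k m m≤ka ka≤m+1)) (proj₁ (growth′ k m m≤ka ka≤m+1)) ,
      multiply m k x x′ y y′ 0≤x′ 0≤y (proj₂ (growth k m m≤ka ka≤m+1)) (proj₂ (growth′ k m m≤ka ka≤m+1))
    where
    open ≤-Reasoning
    multiply : ∀ k m u u′ v v′ → 0# ≤ u′ → 0# ≤ v → u ^ k ≤ C * v ^ m → u′ ^ k ≤ C′ * v′ ^ m →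
               (u * u′) ^ k ≤ C * C′ * (v * v′) ^ m
    multiply k m u u′ v v′ 0≤u′ 0≤v p q = begin
      (u * u′) ^ k                    ≈⟨ ^-distrib-* u u′ k ⟩
      u ^ k * u′ ^ k                  ≤⟨ *-mono-≤ (*-nonNeg 0≤C (^-nonNeg m 0≤v)) (^-nonNeg k 0≤u′) p q ⟩
      C * v ^ m * (C′ * v′ ^ m)       ≈⟨ solve 4 (λ C v C′ v′ → C :* v :* (C′ :* v′) := C :* C′ :* (v :* v′)) refl C (v ^ m) C′ (v′ ^ m) ⟩
      C * C′ * (v ^ m * v′ ^ m)       ≈⟨ *-congˡ (sym (^-distrib-* v v′ m)) ⟩
      C * C′ * (v * v′) ^ m           ∎

  -- For m close to k a, let j be close to m b; since a b = 1, j differs from k by at most a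
  -- constant N depending only on b. Thus `x ^ k` and `x ^ j` agree up to `K ^ N`, and `x ^ j` is
  -- comparable to `y ^ m` by hypothesis.
  growth-inverse : ∀ {x a b y} → 0# < x → 0# ≤ b → a * b ≈ 1# → Growth x b y → Growth y a x
  growth-inverse {x} {a} {b} {y} 0<x 0≤b ab≈1 (C , 0≤C , growth) =
    K ^ N * C , *-nonNeg 0≤Kᴺ 0≤C , inverse
    where
    open ≤-Reasoning
    K = proj₁ (dominator 0<x)
    K-dominates = proj₂ (dominator 0<x)
    N = suc (proj₁ (archimedean b))
    0≤Kᴺ : 0# ≤ K ^ N
    0≤Kᴺ = ^-nonNeg N (≤-trans 0≤1 (proj₁ K-dominates))
    kab≈k : ∀ k → fromℕ k * a * b ≈ fromℕ k
    kab≈k k = trans (*-assoc _ _ _) (trans (*-congˡ ab≈1) (*-identityʳ _))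
    inverse : ∀ k m → fromℕ m ≤ fromℕ k * a → fromℕ k * a ≤ fromℕ (suc m) →
              x ^ k ≤ K ^ N * C * y ^ m × y ^ m ≤ K ^ N * C * x ^ k
    inverse k m m≤ka ka≤m+1 with floor (*-nonNeg (0≤fromℕ m) 0≤b)
    ... | j , j≤mb , mb≤j+1 =
      (begin
        x ^ k                   ≤⟨ proj₁ near ⟩
        K ^ N * x ^ j           ≤⟨ *-monoʳ-≤ 0≤Kᴺ (proj₂ (growth m j j≤mb mb≤j+1)) ⟩
        K ^ N * (C * y ^ m)     ≈⟨ sym (*-assoc _ _ _) ⟩
        K ^ N * C * y ^ m       ∎) ,
      (begin
        y ^ m                   ≤⟨ proj₁ (growth m j j≤mb mb≤j+1) ⟩
        C * x ^ j               ≤⟨ *-monoʳ-≤ 0≤C (proj₂ near) ⟩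
        C * (K ^ N * x ^ k)     ≈⟨ solve 3 (λ C K x → C :* (K :* x) := K :* C :* x) refl C (K ^ N) (x ^ k) ⟩
        K ^ N * C * x ^ k       ∎)
      where
      j≤k : j ℕ.≤ k
      j≤k = fromℕ-cancel-≤ j k (≤-trans j≤mb (≤-trans (*-monoˡ-≤ 0≤b m≤ka) (≤-reflexive (kab≈k k))))
      k≤j+N : k ℕ.≤ j ℕ.+ N
      k≤j+N = fromℕ-cancel-≤ k (j ℕ.+ N) (begin
        fromℕ k                             ≈⟨ sym (kab≈k k) ⟩
        fromℕ k * a * b                     ≤⟨ *-monoˡ-≤ 0≤b ka≤m+1 ⟩
        (1# + fromℕ m) * b                  ≈⟨ solve 2 (λ m b → (con (+ 1) :+ m) :* b := m :* b :+ b) refl (fromℕ m) b ⟩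
        fromℕ m * b + b                     ≤⟨ +-mono-≤ mb≤j+1 (proj₂ (archimedean b)) ⟩
        1# + fromℕ j + fromℕ (ℕ.pred N)     ≈⟨ solve 3 (λ o j n → o :+ j :+ n := j :+ (o :+ n)) refl 1# (fromℕ j) (fromℕ (ℕ.pred N)) ⟩
        fromℕ j + fromℕ N                   ≈⟨ sym (×-homo-+ 1# j N) ⟩
        fromℕ (j ℕ.+ N)                     ∎)
      near = nearby-powers N 0<x K-dominates j≤k k≤j+N

  growth-square : ∀ {x} → 0# < x → Growth x (fromℕ 2) (x * x)
  -- The admissible `m` differ from 2k by at most 1, hence the exponent 1.
  growth-square {x} 0<x = K ^ 1 , ^-nonNeg 1 (≤-trans 0≤1 (proj₁ K-dominates)) , square
    where
    K = proj₁ (dominator 0<x)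
    K-dominates = proj₂ (dominator 0<x)
    x²ᵏ : ∀ k → (x * x) ^ k ≈ x ^ (k ℕ.* 2)
    x²ᵏ k = trans (^-congˡ k (*-congˡ (sym (*-identityʳ x)))) (trans (^-assocʳ x 2 k) (^-congʳ x (ℕ.*-comm 2 k)))
    square : ∀ k m → fromℕ m ≤ fromℕ k * fromℕ 2 → fromℕ k * fromℕ 2 ≤ fromℕ (suc m) →
             (x * x) ^ k ≤ K ^ 1 * x ^ m × x ^ m ≤ K ^ 1 * (x * x) ^ k
    square k m m≤2k 2k≤m+1 = ≤-trans (≤-reflexive (x²ᵏ k)) (proj₁ near) ,
      ≤-trans (proj₂ near) (≤-reflexive (*-congˡ (sym (x²ᵏ k))))
      where
      near = nearby-powers 1 0<x K-dominates
        (fromℕ-cancel-≤ m (k ℕ.* 2) (≤-trans m≤2k (≤-reflexive (sym (×1-homo-* k 2)))))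
        (fromℕ-cancel-≤ (k ℕ.* 2) (m ℕ.+ 1) (≤-trans (≤-reflexive (×1-homo-* k 2)) (≤-trans 2k≤m+1 (≤-reflexive (×-congˡ (ℕ.+-comm 1 m))))))

  ^ᴿ-monoˡ-≤ : ∀ {x y a} → 0# < a → 0# ≤ x → x ≤ y → x ^ᴿ a ≤ y ^ᴿ a
  ^ᴿ-monoˡ-≤ {x} {y} 0<a 0≤x x≤y with ≤⊎< x 0#
  ... | inj₁ x≤0 = ≤-trans (^ᴿ-zero 0≤x x≤0 0<a) (^ᴿ-nonNeg (≤-trans 0≤x x≤y) (<⇒≤ 0<a))
  ... | inj₂ 0<x = growth-≤ 0≤x (<⇒≤ 0<a) (^ᴿ-nonNeg (<⇒≤ 0<y) (<⇒≤ 0<a)) x≤y (^ᴿ-growth 0<x (<⇒≤ 0<a)) (^ᴿ-growth 0<y (<⇒≤ 0<a))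
    where
    0<y : 0# < y
    0<y = <-≤-trans 0<x x≤y

  ^ᴿ-congˡ : ∀ {x y a} → 0# < a → 0# ≤ x → x ≈ y → x ^ᴿ a ≈ y ^ᴿ a
  ^ᴿ-congˡ 0<a 0≤x x≈y = ≤-antisym (^ᴿ-monoˡ-≤ 0<a 0≤x (≤-reflexive x≈y))
    (^ᴿ-monoˡ-≤ 0<a (≤-trans 0≤x (≤-reflexive x≈y)) (≤-reflexive (sym x≈y)))

  growth-unique : ∀ {x a y} → 0# < x → 0# ≤ a → 0# ≤ y → Growth x a y → x ^ᴿ a ≈ y
  growth-unique 0<x 0≤a 0≤y growth = ≤-antisym
    (growth-≤ (<⇒≤ 0<x) 0≤a 0≤y ≤-refl (^ᴿ-growth 0<x 0≤a) growth)
    (growth-≤ (<⇒≤ 0<x) 0≤a (^ᴿ-nonNeg (<⇒≤ 0<x) 0≤a) ≤-refl growth (^ᴿ-growth 0<x 0≤a))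

  ^ᴿ-distrib-* : ∀ {x y a} → 0# < x → 0# < y → 0# ≤ a → (x * y) ^ᴿ a ≈ x ^ᴿ a * y ^ᴿ a
  ^ᴿ-distrib-* 0<x 0<y 0≤a = growth-unique (*-positive 0<x 0<y) 0≤a (*-nonNeg 0≤xᵃ 0≤yᵃ)
    (growth-* (<⇒≤ 0<x) (<⇒≤ 0<y) 0≤xᵃ 0≤yᵃ (^ᴿ-growth 0<x 0≤a) (^ᴿ-growth 0<y 0≤a))
    where
    0≤xᵃ = ^ᴿ-nonNeg (<⇒≤ 0<x) 0≤a
    0≤yᵃ = ^ᴿ-nonNeg (<⇒≤ 0<y) 0≤a

  ^ᴿ-inverse : ∀ {x a} → 0# < x → 0# < a → (x ^ᴿ (a ⁻¹)) ^ᴿ a ≈ x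
  ^ᴿ-inverse 0<x 0<a = growth-unique (^ᴿ-positive 0<x 0≤a⁻¹) (<⇒≤ 0<a) (<⇒≤ 0<x)
    (growth-inverse 0<x 0≤a⁻¹ (⁻¹-inverseʳ (>⇒≉ 0<a)) (^ᴿ-growth 0<x 0≤a⁻¹))
    where 0≤a⁻¹ = <⇒≤ (0<⁻¹ 0<a)

  0<2 : 0# < fromℕ 2
  0<2 = 0<fromℕ-suc 1

  ^ᴿ-2 : ∀ {x} → 0# ≤ x → x ^ᴿ fromℕ 2 ≈ x * x
  ^ᴿ-2 {x} 0≤x with ≤⊎< x 0#
  ... | inj₂ 0<x = growth-unique 0<x (<⇒≤ 0<2) (0≤x² x) (growth-square 0<x)
  ... | inj₁ x≤0 = ≤-antisym (≤-trans (^ᴿ-zero 0≤x x≤0 0<2) (0≤x² x))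
        (≤-trans (≤-trans (*-monoˡ-≤ 0≤x x≤0) (≤-reflexive (zeroˡ x))) (^ᴿ-nonNeg 0≤x (<⇒≤ 0<2)))

  sqrt-≤ : ∀ {x c} → 0# ≤ x → 0# ≤ c → x ≤ c * c → x ^ᴿ (fromℕ 2 ⁻¹) ≤ c
  sqrt-≤ {x} {c} 0≤x 0≤c x≤c² with ≤⊎< x 0#
  ... | inj₁ x≤0 = ≤-trans (^ᴿ-zero 0≤x x≤0 (0<⁻¹ 0<2)) 0≤c
  ... | inj₂ 0<x = ^-cancelˡ-≤ 1 0≤c (begin
    r ^ 2             ≈⟨ *-congˡ (*-identityʳ r) ⟩
    r * r             ≈⟨ sym (^ᴿ-2 0≤r) ⟩
    r ^ᴿ fromℕ 2      ≈⟨ ^ᴿ-inverse 0<x 0<2 ⟩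
    x                 ≤⟨ x≤c² ⟩
    c * c             ≈⟨ *-congˡ (sym (*-identityʳ c)) ⟩
    c ^ 2             ∎)
    where
    open ≤-Reasoning
    r = x ^ᴿ (fromℕ 2 ⁻¹)
    0≤r : 0# ≤ r
    0≤r = ^ᴿ-nonNeg 0≤x (<⇒≤ (0<⁻¹ 0<2))

  -- Quadratic forms and volumes of finite families of vectors

  -- The axioms do not state that `_⁻¹` respects `_≈_`; away from zero this follows from the
  -- uniqueness of inverses.
  ⁻¹-cong : ∀ {x y} → 0# < x → x ≈ y → x ⁻¹ ≈ y ⁻¹
  ⁻¹-cong {x} {y} 0<x x≈y = begin
    x ⁻¹               ≈⟨ sym (*-identityʳ _) ⟩
    x ⁻¹ * 1#          ≈⟨ *-congˡ (sym (⁻¹-inverseʳ (>⇒≉ 0<y))) ⟩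
    x ⁻¹ * (y * y ⁻¹)  ≈⟨ sym (*-assoc _ _ _) ⟩
    x ⁻¹ * y * y ⁻¹    ≈⟨ *-congʳ (*-congˡ (sym x≈y)) ⟩
    x ⁻¹ * x * y ⁻¹    ≈⟨ *-congʳ (⁻¹-inverseˡ (>⇒≉ 0<x)) ⟩
    1# * y ⁻¹          ≈⟨ *-identityˡ _ ⟩
    y ⁻¹               ∎
    where
    open ≈-Reasoning
    0<y : 0# < y
    0<y = <-≤-trans 0<x (≤-reflexive x≈y)

  *-cancelˡ-≈ : ∀ {x y z} → 0# < z → z * x ≈ z * y → x ≈ y
  *-cancelˡ-≈ 0<z zx≈zy = ≤-antisym (*-cancelˡ-≤ 0<z (≤-reflexive zx≈zy)) (*-cancelˡ-≤ 0<z (≤-reflexive (sym zx≈zy)))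

  -- For identities of fractions: the ring solver provides the hypothesis, in which t ≈ s is a
  -- relation such as (1 + β) * (1 + β) ⁻¹ ≈ 1 and c is its cofactor.
  modulo : ∀ {x y c t s} → t ≈ s → x ≈ y + c * (t - s) → x ≈ y
  modulo {x} {y} {c} {t} {s} t≈s x≈ = begin
    x                ≈⟨ x≈ ⟩
    y + c * (t - s)  ≈⟨ +-congˡ (*-congˡ (+-congʳ t≈s)) ⟩
    y + c * (s - s)  ≈⟨ solve 3 (λ y c s → y :+ c :* (s :- s) := y) refl y c s ⟩
    y                ∎
    where open ≈-Reasoning

  0<1+ : ∀ {x} → 0# ≤ x → 0# < 1# + x
  0<1+ 0≤x = <-≤-trans 0<1 (x≤x+y 0≤x)

  sum-mono-≤ : ∀ {n} {f g : Vector ℝ n} → (∀ i → f i ≤ g i) → sum f ≤ sum g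
  sum-mono-≤ {zero}  f≤g = ≤-refl
  sum-mono-≤ {suc n} f≤g = +-mono-≤ (f≤g zero) (sum-mono-≤ (λ i → f≤g (suc i)))

  sum-nonNeg : ∀ {n} {f : Vector ℝ n} → (∀ i → 0# ≤ f i) → 0# ≤ sum f
  sum-nonNeg {n} 0≤f = ≤-trans (≤-reflexive (sym (sum-replicate-zero n))) (sum-mono-≤ 0≤f)

  sum-linear : ∀ {n} (f g : Vector ℝ n) c → sum (λ i → f i - c * g i) ≈ sum f - c * sum g
  sum-linear f g c = begin
    sum (λ i → f i - c * g i)             ≈⟨ sum-cong-≋ (λ i → +-congˡ (-‿distribˡ-* c (g i))) ⟩
    sum (λ i → f i + - c * g i)           ≈⟨ ∑-distrib-+ f (λ i → - c * g i) ⟩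
    sum f + sum (λ i → - c * g i)         ≈⟨ +-congˡ (sym (*-distribˡ-sum (- c) g)) ⟩
    sum f + - c * sum g                   ≈⟨ +-congˡ (sym (-‿distribˡ-* c (sum g))) ⟩
    sum f - c * sum g                     ∎
    where open ≈-Reasoning

  -- Shaped for a rank-one update, in which each factor of a summand is its old value minus a fixed
  -- multiple of another old value.
  sum-bilinear : ∀ {n} (f g f′ g′ : Vector ℝ n) s t →
    sum (λ i → (f i - s * g i) * (f′ i - t * g′ i)) ≈
    sum (λ i → f i * f′ i) - t * sum (λ i → f i * g′ i) - s * (sum (λ i → g i * f′ i) - t * sum (λ i → g i * g′ i))
  sum-bilinear f g f′ g′ s t = begin
    sum (λ i → (f i - s * g i) * (f′ i - t * g′ i))
      ≈⟨ sum-cong-≋ (λ i → solve 6 (λ f g f′ g′ s t → (f :- s :* g) :* (f′ :- t :* g′) :=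
           (f :* f′ :- t :* (f :* g′)) :- s :* (g :* f′ :- t :* (g :* g′))) refl (f i) (g i) (f′ i) (g′ i) s t) ⟩
    sum (λ i → (f i * f′ i - t * (f i * g′ i)) - s * (g i * f′ i - t * (g i * g′ i)))
      ≈⟨ sum-linear (λ i → f i * f′ i - t * (f i * g′ i)) (λ i → g i * f′ i - t * (g i * g′ i)) s ⟩
    sum (λ i → f i * f′ i - t * (f i * g′ i)) - s * sum (λ i → g i * f′ i - t * (g i * g′ i))
      ≈⟨ +-cong (sum-linear (λ i → f i * f′ i) (λ i → f i * g′ i) t)
           (-‿cong (*-congˡ (sum-linear (λ i → g i * f′ i) (λ i → g i * g′ i) t))) ⟩
    sum (λ i → f i * f′ i) - t * sum (λ i → f i * g′ i) - s * (sum (λ i → g i * f′ i) - t * sum (λ i → g i * g′ i)) ∎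
    where open ≈-Reasoning

  scaled-unit : ∀ {d} → ℝ → Fin d → Vector ℝ d
  scaled-unit c zero    zero    = c
  scaled-unit c zero    (suc l) = 0#
  scaled-unit c (suc k) zero    = 0#
  scaled-unit c (suc k) (suc l) = scaled-unit c k l

  scaled-unit-sym : ∀ {d} c (k l : Fin d) → scaled-unit c k l ≡ scaled-unit c l k
  scaled-unit-sym c zero    zero    = ≡.refl
  scaled-unit-sym c zero    (suc l) = ≡.refl
  scaled-unit-sym c (suc k) zero    = ≡.refl
  scaled-unit-sym c (suc k) (suc l) = scaled-unit-sym c k l

  scaled-unit-diagonal : ∀ {d} c (k : Fin d) → scaled-unit c k k ≡ c
  scaled-unit-diagonal c zero    = ≡.refl
  scaled-unit-diagonal c (suc k) = scaled-unit-diagonal c k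

  sum-scaled-unit : ∀ {d} c (k : Fin d) (g : Vector ℝ d) → sum (λ l → g l * scaled-unit c k l) ≈ g k * c
  sum-scaled-unit {suc d} c zero g = begin
    g zero * c + sum (λ l → g (suc l) * 0#)  ≈⟨ +-congˡ (sym (*-distribʳ-sum 0# (λ l → g (suc l)))) ⟩
    g zero * c + sum (λ l → g (suc l)) * 0#  ≈⟨ trans (+-congˡ (zeroʳ _)) (+-identityʳ _) ⟩
    g zero * c                               ∎
    where open ≈-Reasoning
  sum-scaled-unit {suc d} c (suc k) g = trans (+-congʳ (zeroʳ _)) (trans (+-identityˡ _) (sum-scaled-unit c k (λ l → g (suc l))))

  module Forms (d : ℕ) (δ : ℝ) (0<δ : 0# < δ) where

    V : Set
    V = Vector ℝ d

    -- For M = Σ w wᵀ over w in frame us, form us x y is xᵀ M⁻¹ y by the Sherman–Morrison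
    -- formula, and volume us is det M up to the constant factor det (δ² I).
    form : List V → V → V → ℝ
    form []       x y = sum (λ k → (δ ⁻¹ * x k) * (δ ⁻¹ * y k))
    form (u ∷ us) x y = form us x y - form us x u * form us u y * (1# + form us u u) ⁻¹

    volume : List V → ℝ
    volume []       = 1#
    volume (u ∷ us) = volume us * (1# + form us u u)

    frame : (us : List V) → Vector V (length us ℕ.+ d)
    frame []       = scaled-unit δ
    frame (u ∷ us) = u Vector.∷ frame us

    form-sym : ∀ us x y → form us x y ≈ form us y x
    form-sym []       x y = sum-cong-≋ (λ k → *-comm (δ ⁻¹ * x k) (δ ⁻¹ * y k))
    form-sym (u ∷ us) x y = +-cong (form-sym us x y)
      (-‿cong (*-congʳ (trans (*-cong (form-sym us x u) (form-sym us u y)) (*-comm _ _))))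

    form-unit : ∀ x k → form [] x (scaled-unit δ k) ≈ δ ⁻¹ * x k
    form-unit x k = begin
      sum (λ l → (δ ⁻¹ * x l) * (δ ⁻¹ * scaled-unit δ k l))  ≈⟨ sum-cong-≋ (λ l → sym (*-assoc (δ ⁻¹ * x l) (δ ⁻¹) (scaled-unit δ k l))) ⟩
      sum (λ l → δ ⁻¹ * x l * δ ⁻¹ * scaled-unit δ k l)      ≈⟨ sum-scaled-unit δ k (λ l → δ ⁻¹ * x l * δ ⁻¹) ⟩
      δ ⁻¹ * x k * δ ⁻¹ * δ                                  ≈⟨ *-assoc _ _ _ ⟩
      δ ⁻¹ * x k * (δ ⁻¹ * δ)                                ≈⟨ *-congˡ (⁻¹-inverseˡ (>⇒≉ 0<δ)) ⟩
      δ ⁻¹ * x k * 1#                                        ≈⟨ *-identityʳ _ ⟩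
      δ ⁻¹ * x k                                             ∎
      where open ≈-Reasoning

    -- This is M⁻¹ M M⁻¹ = M⁻¹ with M = Σ w wᵀ. It yields both positivity of the form and the
    -- Euclidean length of the coefficient vectors.
    Reproducing : List V → Set
    Reproducing us = ∀ x y → sum (λ j → form us x (frame us j) * form us (frame us j) y) ≈ form us x y

    -- By symmetry the reproduced value at `x` is a sum of squares. Reproduction is taken as a
    -- hypothesis because its own induction needs 1 + uᵀ M⁻¹ u > 0 for the shorter list.
    reproducing⇒nonNeg : ∀ us → Reproducing us → ∀ x → 0# ≤ form us x x
    reproducing⇒nonNeg us reproducing x = ≤-trans
      (sum-nonNeg {f = λ j → form us x (frame us j) * form us (frame us j) x}
        (λ j → ≤-trans (0≤x² (form us x (frame us j))) (≤-reflexive (*-congˡ (form-sym us x (frame us j))))))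
      (≤-reflexive (reproducing x x))

    form-reproducing : ∀ us → Reproducing us
    form-reproducing [] x y = sum-cong-≋ (λ k → *-cong (form-unit x k) (trans (form-sym [] _ y) (form-unit y k)))
    form-reproducing (u ∷ us) x y = begin
      form (u ∷ us) x u * form (u ∷ us) u y + sum (λ j → form (u ∷ us) x (w j) * form (u ∷ us) (w j) y)
        ≈⟨ +-congˡ (sum-cong-≋ (λ j → solve 7 (λ Qxw a q Qwy r b i → (Qxw :- a :* q :* i) :* (Qwy :- r :* b :* i) :=
             (Qxw :- a :* i :* q) :* (Qwy :- b :* i :* r)) refl
             (form us x (w j)) a (form us u (w j)) (form us (w j) y) (form us (w j) u) b i)) ⟩
      form (u ∷ us) x u * form (u ∷ us) u y + sum (λ j → (form us x (w j) - a * i * form us u (w j)) * (form us (w j) y - b * i * form us (w j) u))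
        ≈⟨ +-congˡ (sum-bilinear (λ j → form us x (w j)) (λ j → form us u (w j)) (λ j → form us (w j) y) (λ j → form us (w j) u) (a * i) (b * i)) ⟩
      form (u ∷ us) x u * form (u ∷ us) u y + (S x y - b * i * S x u - a * i * (S u y - b * i * S u u))
        ≈⟨ +-congˡ (+-cong (+-cong (IH x y) (-‿cong (*-congˡ (IH x u)))) (-‿cong (*-congˡ (+-cong (IH u y) (-‿cong (*-congˡ (IH u u))))))) ⟩
      (a - a * β * i) * (b - β * b * i) + (form us x y - b * i * a - a * i * (b - b * i * β))
        ≈⟨ modulo (⁻¹-inverseʳ (>⇒≉ 0<1+β)) (solve 5 (λ q a b β i →
             (a :- a :* β :* i) :* (b :- β :* b :* i) :+ (q :- b :* i :* a :- a :* i :* (b :- b :* i :* β)) :=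
             q :- a :* b :* i :+ (a :* b :* (β :* i :- con (+ 1))) :* ((con (+ 1) :+ β) :* i :- con (+ 1))) refl (form us x y) a b β i) ⟩
      form us x y - a * b * i ∎
      where
      open ≈-Reasoning
      w = frame us
      a = form us x u
      b = form us u y
      β = form us u u
      i = (1# + β) ⁻¹
      S : V → V → ℝ
      S x y = sum (λ j → form us x (w j) * form us (w j) y)
      IH : Reproducing us
      IH = form-reproducing us
      0<1+β : 0# < 1# + β
      0<1+β = 0<1+ (reproducing⇒nonNeg us IH u)

    form-nonNeg : ∀ us x → 0# ≤ form us x x
    form-nonNeg us = reproducing⇒nonNeg us (form-reproducing us)

    0<1+form : ∀ us u → 0# < 1# + form us u u
    0<1+form us u = 0<1+ (form-nonNeg us u)

    -- With β = uᵀ M⁻¹ u, a new vector contributes β / (1 + β). The old vectors together lose Σ (uᵀ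
    -- M⁻¹ w)² / (1 + β), which is the same amount by reproduction, so the initial value d persists.
    trace : ∀ us → sum (λ j → form us (frame us j) (frame us j)) ≈ fromℕ d
    trace [] = trans (sum-cong-≋ (λ k → trans (form-unit _ k) (trans (*-congˡ (reflexive (scaled-unit-diagonal δ k))) (⁻¹-inverseˡ (>⇒≉ 0<δ)))))
      (sum-replicate d)
    trace (u ∷ us) = begin
      form (u ∷ us) u u + sum (λ j → form (u ∷ us) (w j) (w j))
        ≈⟨ +-congˡ (sum-cong-≋ (λ j → solve 4 (λ q r s i → q :- r :* s :* i := q :- i :* (s :* r)) refl
             (form us (w j) (w j)) (form us (w j) u) (form us u (w j)) i)) ⟩
      form (u ∷ us) u u + sum (λ j → form us (w j) (w j) - i * (form us u (w j) * form us (w j) u))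
        ≈⟨ +-congˡ (sum-linear (λ j → form us (w j) (w j)) (λ j → form us u (w j) * form us (w j) u) i) ⟩
      form (u ∷ us) u u + (sum (λ j → form us (w j) (w j)) - i * sum (λ j → form us u (w j) * form us (w j) u))
        ≈⟨ +-congˡ (+-cong (trace us) (-‿cong (*-congˡ (form-reproducing us u u)))) ⟩
      β - β * β * i + (fromℕ d - i * β)
        ≈⟨ modulo (⁻¹-inverseʳ (>⇒≉ (0<1+form us u))) (solve 3 (λ β i n →
             β :- β :* β :* i :+ (n :- i :* β) := n :+ (:- β) :* ((con (+ 1) :+ β) :* i :- con (+ 1))) refl β i (fromℕ d)) ⟩
      fromℕ d ∎
      where
      open ≈-Reasoning
      w = frame us
      β = form us u u
      i = (1# + β) ⁻¹

    -- This is M M⁻¹ x = x. With a = xᵀ M⁻¹ u, adjoining `u` gives it the coefficient a / (1 + β),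
    -- and the changes in the old coefficients remove exactly this multiple of `u`.
    frame-expansion : ∀ us x k → sum (λ j → form us x (frame us j) * frame us j k) ≈ x k
    frame-expansion [] x k = begin
      sum (λ l → form [] x (scaled-unit δ l) * scaled-unit δ l k)  ≈⟨ sum-cong-≋ (λ l → *-cong (form-unit x l) (reflexive (scaled-unit-sym δ l k))) ⟩
      sum (λ l → δ ⁻¹ * x l * scaled-unit δ k l)                   ≈⟨ sum-scaled-unit δ k (λ l → δ ⁻¹ * x l) ⟩
      δ ⁻¹ * x k * δ                                               ≈⟨ solve 3 (λ e x δ → e :* x :* δ := x :* (e :* δ)) refl (δ ⁻¹) (x k) δ ⟩
      x k * (δ ⁻¹ * δ)                                             ≈⟨ *-congˡ (⁻¹-inverseˡ (>⇒≉ 0<δ)) ⟩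
      x k * 1#                                                     ≈⟨ *-identityʳ _ ⟩
      x k                                                          ∎
      where open ≈-Reasoning
    frame-expansion (u ∷ us) x k = begin
      form (u ∷ us) x u * u k + sum (λ j → form (u ∷ us) x (w j) * w j k)
        ≈⟨ +-congˡ (sum-cong-≋ (λ j → solve 5 (λ q a r i c → (q :- a :* r :* i) :* c := q :* c :- a :* i :* (r :* c)) refl
             (form us x (w j)) a (form us u (w j)) i (w j k))) ⟩
      form (u ∷ us) x u * u k + sum (λ j → form us x (w j) * w j k - a * i * (form us u (w j) * w j k))
        ≈⟨ +-congˡ (sum-linear (λ j → form us x (w j) * w j k) (λ j → form us u (w j) * w j k) (a * i)) ⟩
      form (u ∷ us) x u * u k + (sum (λ j → form us x (w j) * w j k) - a * i * sum (λ j → form us u (w j) * w j k))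
        ≈⟨ +-congˡ (+-cong (frame-expansion us x k) (-‿cong (*-congˡ (frame-expansion us u k)))) ⟩
      (a - a * β * i) * u k + (x k - a * i * u k)
        ≈⟨ modulo (⁻¹-inverseʳ (>⇒≉ (0<1+form us u))) (solve 5 (λ a β i u x →
             (a :- a :* β :* i) :* u :+ (x :- a :* i :* u) := x :+ (:- (a :* u)) :* ((con (+ 1) :+ β) :* i :- con (+ 1))) refl a β i (u k) (x k)) ⟩
      x k ∎
      where
      open ≈-Reasoning
      w = frame us
      a = form us x u
      β = form us u u
      i = (1# + β) ⁻¹

    form-decreasing : ∀ u us x → form (u ∷ us) x x ≤ form us x x
    form-decreasing u us x = by-difference
      (*-nonNeg (0≤x² (form us x u)) (<⇒≤ (0<⁻¹ (0<1+form us u))))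
      (trans (solve 4 (λ q a b i → q :- (q :- a :* b :* i) := a :* b :* i) refl (form us x x) (form us x u) (form us u x) ((1# + form us u u) ⁻¹))
        (*-congʳ (*-congˡ (form-sym us u x))))

    form-≤-initial : ∀ us x → form us x x ≤ form [] x x
    form-≤-initial []       x = ≤-refl
    form-≤-initial (u ∷ us) x = ≤-trans (form-decreasing u us x) (form-≤-initial us x)

    volume-positive : ∀ us → 0# < volume us
    volume-positive []       = 0<1
    volume-positive (u ∷ us) = *-positive (volume-positive us) (0<1+form us u)

    volume-bounded : ∀ {B} us → 0# ≤ B → All (λ u → form [] u u ≤ B) us → volume us ≤ (1# + B) ^ length us
    volume-bounded []       0≤B []              = ≤-refl
    volume-bounded {B} (u ∷ us) 0≤B (u≤B ∷ us≤B) = ≤-trans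
      (*-mono-≤ (^-nonNeg (length us) (<⇒≤ (0<1+ 0≤B))) (<⇒≤ (0<1+form us u)) (volume-bounded us 0≤B us≤B)
        (+-monoʳ-≤ 1# (≤-trans (form-≤-initial us u) u≤B)))
      (≤-reflexive (*-comm _ _))

    -- det (M + u uᵀ + v vᵀ) / det M
    gram : List V → V → V → ℝ
    gram us u v = (1# + form us u u) * (1# + form us v v) - form us u v * form us v u

    -- The determinant lemma applied twice: the product of the two update factors multiplies out to
    -- a 2 × 2 determinant whose value does not depend on which vector comes first.
    gram-factors : ∀ us u v → (1# + form us v v) * (1# + form (v ∷ us) u u) ≈ gram us u v
    gram-factors us u v = modulo (⁻¹-inverseʳ (>⇒≉ (0<1+form us v))) (solve 5 (λ a b c c′ i →
      (con (+ 1) :+ b) :* (con (+ 1) :+ (a :- c :* c′ :* i)) :=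
      (con (+ 1) :+ a) :* (con (+ 1) :+ b) :- c :* c′ :+ (:- (c :* c′)) :* ((con (+ 1) :+ b) :* i :- con (+ 1))) refl
      (form us u u) (form us v v) (form us u v) (form us v u) ((1# + form us v v) ⁻¹))

    gram-sym : ∀ us u v → gram us u v ≈ gram us v u
    gram-sym us u v = solve 4 (λ a b c c′ → a :* b :- c :* c′ := b :* a :- c′ :* c) refl
      (1# + form us u u) (1# + form us v v) (form us u v) (form us v u)

    gram-positive : ∀ us u v → 0# < gram us u v
    gram-positive us u v = <-≤-trans (*-positive (0<1+form us v) (0<1+form (v ∷ us) u)) (≤-reflexive (gram-factors us u v))

    -- The row (xᵀ M⁻¹ u, xᵀ M⁻¹ v), times the adjugate of the 2 × 2 matrix with determinant
    -- `gram us u v`, times the column (uᵀ M⁻¹ y, vᵀ M⁻¹ y): the numerator in Woodbury's formula for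
    -- rank two.
    adjugate : List V → V → V → V → V → ℝ
    adjugate us u v x y = (1# + form us u u) * (form us x v * form us v y) + (1# + form us v v) * (form us x u * form us u y)
      - form us v u * (form us x v * form us u y) - form us u v * (form us x u * form us v y)

    -- Clearing denominators turns two nested rank-one corrections into a polynomial expression in
    -- the old form, where exchanging `u` and `v` only permutes terms.
    form-two : ∀ us u v x y → gram us u v * (form us x y - form (u ∷ v ∷ us) x y) ≈ adjugate us u v x y
    form-two us u v x y = begin
      gram us u v * (q - (q - xv * vy * i - xu′ * uy′ * j))
        ≈⟨ solve 6 (λ D q p i r j → D :* (q :- (q :- p :* i :- r :* j)) := p :* (D :* i) :+ r :* (D :* j)) refl
             (gram us u v) q (xv * vy) i (xu′ * uy′) j ⟩
      xv * vy * (gram us u v * i) + xu′ * uy′ * (gram us u v * j)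
        ≈⟨ +-cong (*-congˡ Di≈) (*-congˡ Dj≈) ⟩
      xv * vy * (1# + a - c * c′ * i) + xu′ * uy′ * (1# + b)
        ≈⟨ modulo Bi≈1 (solve 9 (λ a b c c′ i xu xv uy vy →
             xv :* vy :* (con (+ 1) :+ a :- c :* c′ :* i) :+ (xu :- xv :* c′ :* i) :* (uy :- c :* vy :* i) :* (con (+ 1) :+ b) :=
             (con (+ 1) :+ a) :* (xv :* vy) :+ (con (+ 1) :+ b) :* (xu :* uy) :- c′ :* (xv :* uy) :- c :* (xu :* vy)
             :+ (xv :* vy :* c :* c′ :* i :- xu :* c :* vy :- xv :* c′ :* uy) :* ((con (+ 1) :+ b) :* i :- con (+ 1))) refl a b c c′ i xu xv uy vy) ⟩
      adjugate us u v x y ∎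
      where
      open ≈-Reasoning
      q = form us x y
      a = form us u u
      b = form us v v
      c = form us u v
      c′ = form us v u
      xu = form us x u
      xv = form us x v
      uy = form us u y
      vy = form us v y
      i = (1# + b) ⁻¹
      j = (1# + form (v ∷ us) u u) ⁻¹
      xu′ = form (v ∷ us) x u
      uy′ = form (v ∷ us) u y
      Bi≈1 : (1# + b) * i ≈ 1#
      Bi≈1 = ⁻¹-inverseʳ (>⇒≉ (0<1+form us v))
      Di≈ : gram us u v * i ≈ 1# + a - c * c′ * i
      Di≈ = modulo Bi≈1 (solve 5 (λ a b c c′ i → ((con (+ 1) :+ a) :* (con (+ 1) :+ b) :- c :* c′) :* i :=
        con (+ 1) :+ a :- c :* c′ :* i :+ (con (+ 1) :+ a) :* ((con (+ 1) :+ b) :* i :- con (+ 1))) refl a b c c′ i)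
      Dj≈ : gram us u v * j ≈ 1# + b
      Dj≈ = trans (*-congʳ (sym (gram-factors us u v))) (trans (*-assoc _ _ _)
        (trans (*-congˡ (⁻¹-inverseʳ (>⇒≉ (0<1+form (v ∷ us) u)))) (*-identityʳ _)))

    -- Both orders have the same correction after multiplication by the positive factor
    -- `gram us u v`, which can be cancelled. Permutation invariance follows, and lets the exchange
    -- argument bring any chosen vector to the head of the list.
    form-swap : ∀ us u v x y → form (u ∷ v ∷ us) x y ≈ form (v ∷ u ∷ us) x y
    form-swap us u v x y = begin
      form (u ∷ v ∷ us) x y                             ≈⟨ solve 2 (λ p q → q := p :- (p :- q)) refl (form us x y) _ ⟩
      form us x y - (form us x y - form (u ∷ v ∷ us) x y)   ≈⟨ +-congˡ (-‿cong (*-cancelˡ-≈ (gram-positive us u v) (begin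
        gram us u v * (form us x y - form (u ∷ v ∷ us) x y)   ≈⟨ form-two us u v x y ⟩
        adjugate us u v x y                                   ≈⟨ solve 8 (λ a p b q c r c′ s → a :* p :+ b :* q :- c :* r :- c′ :* s := b :* q :+ a :* p :- c′ :* s :- c :* r) refl
                                                                   (1# + form us u u) (form us x v * form us v y) (1# + form us v v) (form us x u * form us u y)
                                                                   (form us v u) (form us x v * form us u y) (form us u v) (form us x u * form us v y) ⟩
        adjugate us v u x y                                   ≈⟨ sym (form-two us v u x y) ⟩
        gram us v u * (form us x y - form (v ∷ u ∷ us) x y)   ≈⟨ *-congʳ (gram-sym us v u) ⟩
        gram us u v * (form us x y - form (v ∷ u ∷ us) x y)   ∎))) ⟩
      form us x y - (form us x y - form (v ∷ u ∷ us) x y)   ≈⟨ solve 2 (λ p q → p :- (p :- q) := q) refl (form us x y) _ ⟩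
      form (v ∷ u ∷ us) x y                             ∎
      where open ≈-Reasoning

    form-prep : ∀ us vs u → (∀ x y → form us x y ≈ form vs x y) → ∀ x y → form (u ∷ us) x y ≈ form (u ∷ vs) x y
    form-prep us vs u us≈vs x y = +-cong (us≈vs x y) (-‿cong (*-cong (*-cong (us≈vs x u) (us≈vs u y))
      (⁻¹-cong (0<1+form us u) (+-congˡ (us≈vs u u)))))

    form-↭ : ∀ {us vs} → us ↭ vs → ∀ x y → form us x y ≈ form vs x y
    form-↭ Perm.refl             x y = refl
    form-↭ (Perm.prep {us} {vs} u p) = form-prep us vs u (form-↭ p)
    form-↭ (Perm.swap {us} {vs} u v p) x y = trans (form-swap us u v x y) (form-prep (u ∷ us) (u ∷ vs) v (form-prep us vs u (form-↭ p)) x y)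
    form-↭ (Perm.trans p q)      x y = trans (form-↭ p x y) (form-↭ q x y)

    volume-swap : ∀ us u v → volume (u ∷ v ∷ us) ≈ volume (v ∷ u ∷ us)
    volume-swap us u v = trans (*-assoc _ _ _) (trans (*-congˡ (trans (gram-factors us u v)
      (trans (gram-sym us u v) (sym (gram-factors us v u))))) (sym (*-assoc _ _ _)))

    volume-prep : ∀ {us vs} u → us ↭ vs → volume us ≈ volume vs → volume (u ∷ us) ≈ volume (u ∷ vs)
    volume-prep u p us≈vs = *-cong us≈vs (+-congˡ (form-↭ p u u))

    volume-↭ : ∀ {us vs} → us ↭ vs → volume us ≈ volume vs
    volume-↭ Perm.refl         = refl
    volume-↭ (Perm.prep u p)   = volume-prep u p (volume-↭ p)
    volume-↭ (Perm.swap {us} u v p) = trans (volume-swap us u v) (volume-prep v (Perm.prep u p) (volume-prep u p (volume-↭ p)))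
    volume-↭ (Perm.trans p q)  = trans (volume-↭ p) (volume-↭ q)

    length≤sum-frame : ∀ {g : V → ℝ} us → (∀ x → 0# ≤ g x) → All (λ u → 1# ≤ g u) us →
                       fromℕ (length us) ≤ sum (λ j → g (frame us j))
    length≤sum-frame []       0≤g []           = sum-nonNeg (λ k → 0≤g (scaled-unit δ k))
    length≤sum-frame (u ∷ us) 0≤g (1≤gu ∷ 1≤g) = +-mono-≤ 1≤gu (length≤sum-frame us 0≤g 1≤g)

    -- The squared lengths form us w w sum to d over the frame, so among 3d vectors one has at most 1/2.
    small-vector : ∀ us → length us ≡ 3 ℕ.* d → 0 ℕ.< d →
                   ∃[ u ] ∃[ vs ] us ↭ u ∷ vs × fromℕ 2 * form us u u ≤ 1#
    small-vector us |us|≡3d 0<d with em {∃[ u ] ∃[ vs ] us ↭ u ∷ vs × fromℕ 2 * form us u u ≤ 1#}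
    ... | yes p = p
    ... | no ¬p = ⊥-elim (ℕ.<⇒≱ 2d<3d (fromℕ-cancel-≤ (3 ℕ.* d) (2 ℕ.* d) (begin
      fromℕ (3 ℕ.* d)                                               ≡⟨ ≡.cong fromℕ (≡.sym |us|≡3d) ⟩
      fromℕ (length us)                                             ≤⟨ length≤sum-frame {g} us 0≤g (All.tabulate large) ⟩
      sum (λ j → g (frame us j))                                    ≈⟨ sym (*-distribˡ-sum (fromℕ 2) (λ j → form us (frame us j) (frame us j))) ⟩
      fromℕ 2 * sum (λ j → form us (frame us j) (frame us j))       ≈⟨ *-congˡ (trace us) ⟩
      fromℕ 2 * fromℕ d                                             ≈⟨ sym (×1-homo-* 2 d) ⟩
      fromℕ (2 ℕ.* d)                                               ∎)))
      where
      open ≤-Reasoning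
      g : V → ℝ
      g x = fromℕ 2 * form us x x
      0≤g : ∀ x → 0# ≤ g x
      0≤g x = *-nonNeg (0≤fromℕ 2) (form-nonNeg us x)
      2d<3d : 2 ℕ.* d ℕ.< 3 ℕ.* d
      2d<3d = ℕ.+-monoˡ-≤ (2 ℕ.* d) 0<d
      large : ∀ {u} → u ∈ us → 1# ≤ g u
      large {u} u∈us with ∈-∃++ u∈us
      ... | xs , ys , ≡.refl = <⇒≤ (λ gu≤1 → ¬p (u , xs List.++ ys , shift u xs ys , gu≤1))

    -- Families of nearly maximal volume and the exchange of a vector

    module Exchange (K : V → Set) (B : ℝ) (0≤B : 0# ≤ B) (K-bounded : ∀ {u} → K u → form [] u u ≤ B)
                    (u₀ : V) (u₀∈K : K u₀) where

      Admissible : List V → Set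
      Admissible us = length us ≡ 3 ℕ.* d × All K us

      -- Repetitions are allowed, so copies of a single point show that the set of volumes is
      -- inhabited and its supremum positive.
      initial : List V
      initial = replicate (3 ℕ.* d) u₀

      initial-admissible : Admissible initial
      initial-admissible = List.length-replicate (3 ℕ.* d) , All.replicate⁺ (3 ℕ.* d) u₀∈K

      -- The supremum `F` of the volumes is positive, so F / 2 is not an upper bound, and a family
      -- whose volume exceeds F / 2 will do. This takes the place of compactness.
      near-maximal : ∃[ us ] Admissible us × (∀ vs → Admissible vs → volume vs ≤ fromℕ 2 * volume us)
      near-maximal with em {∃[ us ] Admissible us × (∀ vs → Admissible vs → volume vs ≤ fromℕ 2 * volume us)}
      ... | yes p = p
      ... | no ¬p = ⊥-elim (0<F (by-difference
              (0≤y-x (≤-trans (*-monoʳ-≤ (0≤fromℕ 2) (least half-bound)) (≤-reflexive (cancel F))))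
              (solve 1 (λ F → con (+ 0) :- F := F :- (con (+ 1) :+ (con (+ 1) :+ con (+ 0))) :* F) refl F)))
        where
        Volumes : ℝ → Set
        Volumes r = ∃[ us ] Admissible us × r ≈ volume us
        bounded : UpperBound Volumes ((1# + B) ^ (3 ℕ.* d))
        bounded (us , (|us| , us∈K) , r≈) = ≤-trans (≤-reflexive r≈) (≤-trans
          (volume-bounded us 0≤B (All.map K-bounded us∈K)) (≤-reflexive (^-congʳ (1# + B) |us|)))
        supremum : ∃ (IsLub Volumes)
        supremum = complete Volumes (volume initial , initial , initial-admissible , refl) (_ , λ {x} → bounded {x})
        F = proj₁ supremum
        bound = proj₁ (proj₂ supremum)
        least = proj₂ (proj₂ supremum)
        0<F : 0# < F
        0<F = <-≤-trans (volume-positive initial) (bound (initial , initial-admissible , refl))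
        cancel : ∀ y → fromℕ 2 * (fromℕ 2 ⁻¹ * y) ≈ y
        cancel y = trans (sym (*-assoc _ _ _)) (trans (*-congʳ (⁻¹-inverseʳ (>⇒≉ 0<2))) (*-identityˡ y))
        half-bound : UpperBound Volumes (fromℕ 2 ⁻¹ * F)
        half-bound {r} (us , us-admissible , r≈) with ≤⊎< (fromℕ 2 * volume us) F
        ... | inj₁ 2vol≤F = ≤-trans (≤-reflexive r≈) (*-cancelˡ-≤ 0<2 (≤-trans 2vol≤F (≤-reflexive (sym (cancel F)))))
        ... | inj₂ F<2vol = ⊥-elim (¬p (us , us-admissible ,
              λ vs vs-admissible → ≤-trans (bound (vs , vs-admissible , refl)) (<⇒≤ F<2vol)))

      -- Exchanging a vector with form us u u ≤ 1/2 for y multiplies the volume by at least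
      -- (1 + form us y y) / 2, which near-maximality bounds by 2.
      well-conditioned : 0 ℕ.< d → ∃[ us ] length us ≡ 3 ℕ.* d × All K us × (∀ y → K y → form us y y ≤ fromℕ 4)
      well-conditioned 0<d with near-maximal
      ... | us , us-admissible@(|us| , us∈K) , maximal with small-vector us |us| 0<d
      ... | u , vs , us↭ , 2b≤1 = us , |us| , us∈K , bound
        where
        open ≤-Reasoning
        β = form vs u u
        i = (1# + β) ⁻¹
        -- By Sherman-Morrison `form us u u` equals β / (1 + β), and this is at most 1/2.
        β≤1 : β ≤ 1#
        β≤1 = by-difference (0≤y-x 2β≤1+β) (solve 1 (λ β → con (+ 1) :- β := con (+ 1) :+ β :- (con (+ 1) :+ (con (+ 1) :+ con (+ 0))) :* β) refl β)
          where
          2β≤1+β : fromℕ 2 * β ≤ 1# + β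
          2β≤1+β = begin
            fromℕ 2 * β                                ≈⟨ *-congˡ (sym (modulo (⁻¹-inverseʳ (>⇒≉ (0<1+form vs u))) (solve 2 (λ β i →
               (β :- β :* β :* i) :* (con (+ 1) :+ β) := β :+ (:- (β :* β)) :* ((con (+ 1) :+ β) :* i :- con (+ 1))) refl β i))) ⟩
            fromℕ 2 * ((β - β * β * i) * (1# + β))     ≈⟨ sym (*-assoc _ _ _) ⟩
            fromℕ 2 * form (u ∷ vs) u u * (1# + β)     ≈⟨ *-congʳ (*-congˡ (sym (form-↭ us↭ u u))) ⟩
            fromℕ 2 * form us u u * (1# + β)           ≤⟨ *-monoˡ-≤ (<⇒≤ (0<1+form vs u)) 2b≤1 ⟩
            1# * (1# + β)                              ≈⟨ *-identityˡ _ ⟩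
            1# + β                                     ∎
        bound : ∀ y → K y → form us y y ≤ fromℕ 4
        bound y y∈K = begin
          form us y y             ≈⟨ form-↭ us↭ y y ⟩
          form (u ∷ vs) y y       ≤⟨ form-decreasing u vs y ⟩
          -- Giving away 1 here leaves the perfect square 4, hence an integer constant for the norm.
          form vs y y             ≤⟨ x≤x+y 0≤1 ⟩
          form vs y y + 1#        ≈⟨ +-comm _ _ ⟩
          1# + form vs y y        ≤⟨ *-cancelˡ-≤ (volume-positive vs) exchanged ⟩
          fromℕ 4                 ∎
          where
          exchanged-admissible : Admissible (y ∷ vs)
          exchanged-admissible with All-resp-↭ us↭ us∈K
          ... | _ ∷ vs∈K = ≡.trans (≡.sym (↭-length us↭)) |us| , y∈K ∷ vs∈K
          exchanged : volume vs * (1# + form vs y y) ≤ volume vs * fromℕ 4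
          exchanged = begin
            volume (y ∷ vs)                        ≤⟨ maximal (y ∷ vs) exchanged-admissible ⟩
            fromℕ 2 * volume us                    ≈⟨ *-congˡ (volume-↭ us↭) ⟩
            fromℕ 2 * (volume vs * (1# + β))       ≤⟨ *-monoʳ-≤ (0≤fromℕ 2) (*-monoʳ-≤ (<⇒≤ (volume-positive vs)) (+-monoʳ-≤ 1# β≤1)) ⟩
            fromℕ 2 * (volume vs * (1# + 1#))      ≈⟨ solve 1 (λ v → (con (+ 1) :+ (con (+ 1) :+ con (+ 0))) :* (v :* (con (+ 1) :+ con (+ 1))) :=
                                                        v :* (con (+ 1) :+ (con (+ 1) :+ (con (+ 1) :+ (con (+ 1) :+ con (+ 0)))))) refl (volume vs) ⟩
            volume vs * fromℕ 4                    ∎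

  -- Absolute values and preimages

  x≤∣x∣ : ∀ x → x ≤ ∣ x ∣
  x≤∣x∣ x = x≤x⊔y x (- x)

  -x≤∣x∣ : ∀ x → - x ≤ ∣ x ∣
  -x≤∣x∣ x = x≤y⊔x x (- x)

  0≤∣x∣ : ∀ x → 0# ≤ ∣ x ∣
  0≤∣x∣ x with total 0# x
  ... | inj₁ 0≤x = ≤-trans 0≤x (x≤∣x∣ x)
  ... | inj₂ x≤0 = ≤-trans (≤-trans (≤-reflexive (sym -0≈0)) (neg-mono-≤ x≤0)) (-x≤∣x∣ x)

  ∣∣-cong : ∀ {x y} → x ≈ y → ∣ x ∣ ≈ ∣ y ∣
  ∣∣-cong x≈y = ≤-antisym (half x≈y) (half (sym x≈y))
    where
    half : ∀ {x y} → x ≈ y → ∣ x ∣ ≤ ∣ y ∣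
    half {x} {y} x≈y = ⊔-lub (≤-trans (≤-reflexive x≈y) (x≤∣x∣ y)) (≤-trans (≤-reflexive (-‿cong x≈y)) (-x≤∣x∣ y))

  ∣x∣≤0⇒x≈0 : ∀ {x} → ∣ x ∣ ≤ 0# → x ≈ 0#
  ∣x∣≤0⇒x≈0 {x} ∣x∣≤0 = ≤-antisym (≤-trans (x≤∣x∣ x) ∣x∣≤0) (begin
    0#       ≈⟨ sym -0≈0 ⟩
    - 0#     ≤⟨ neg-mono-≤ (≤-trans (-x≤∣x∣ x) ∣x∣≤0) ⟩
    - - x    ≈⟨ -‿involutive x ⟩
    x        ∎)
    where open ≤-Reasoning

  nonNeg⇒∣x∣≤x : ∀ {x} → 0# ≤ x → ∣ x ∣ ≤ x
  nonNeg⇒∣x∣≤x 0≤x = ⊔-lub ≤-refl (≤-trans (neg-mono-≤ 0≤x) (≤-trans (≤-reflexive -0≈0) 0≤x))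

  ∣0∣≤0 : ∣ 0# ∣ ≤ 0#
  ∣0∣≤0 = nonNeg⇒∣x∣≤x ≤-refl

  ∣x+y∣≤ : ∀ x y → ∣ x + y ∣ ≤ ∣ x ∣ + ∣ y ∣
  ∣x+y∣≤ x y = ⊔-lub (+-mono-≤ (x≤∣x∣ x) (x≤∣x∣ y))
    (≤-trans (≤-reflexive (solve 2 (λ x y → :- (x :+ y) := :- x :+ :- y) refl x y)) (+-mono-≤ (-x≤∣x∣ x) (-x≤∣x∣ y)))

  ∣-x∣≤ : ∀ x → ∣ - x ∣ ≤ ∣ x ∣
  ∣-x∣≤ x = ⊔-lub (-x≤∣x∣ x) (≤-trans (≤-reflexive (-‿involutive x)) (x≤∣x∣ x))

  ∣x-y∣≤ : ∀ x y → ∣ x - y ∣ ≤ ∣ x ∣ + ∣ y ∣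
  ∣x-y∣≤ x y = ≤-trans (∣x+y∣≤ x (- y)) (+-monoʳ-≤ _ (∣-x∣≤ y))

  ∣x*y∣≤ : ∀ x y → ∣ x * y ∣ ≤ ∣ x ∣ * ∣ y ∣
  ∣x*y∣≤ x y with total 0# x
  ... | inj₁ 0≤x = ⊔-lub
        (*-mono-≤′ 0≤x (x≤∣x∣ x) (x≤∣x∣ y))
        (≤-trans (≤-reflexive (-‿distribʳ-* x y)) (*-mono-≤′ 0≤x (x≤∣x∣ x) (-x≤∣x∣ y)))
    where
    *-mono-≤′ : ∀ {a b c} → 0# ≤ a → a ≤ b → c ≤ ∣ y ∣ → a * c ≤ b * ∣ y ∣
    *-mono-≤′ 0≤a a≤b c≤ = ≤-trans (*-monoʳ-≤ 0≤a c≤) (*-monoˡ-≤ (0≤∣x∣ y) a≤b)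
  ... | inj₂ x≤0 = ⊔-lub
        (≤-trans (≤-reflexive (solve 2 (λ x y → x :* y := :- x :* :- y) refl x y)) (*-mono-≤′ (-x≤∣x∣ x) (-x≤∣x∣ y)))
        (≤-trans (≤-reflexive (-‿distribˡ-* x y)) (*-mono-≤′ (-x≤∣x∣ x) (x≤∣x∣ y)))
    where
    0≤-x : 0# ≤ - x
    0≤-x = ≤-trans (≤-reflexive (sym -0≈0)) (neg-mono-≤ x≤0)
    *-mono-≤′ : ∀ {b c} → - x ≤ b → c ≤ ∣ y ∣ → - x * c ≤ b * ∣ y ∣
    *-mono-≤′ a≤b c≤ = ≤-trans (*-monoʳ-≤ 0≤-x c≤) (*-monoˡ-≤ (0≤∣x∣ y) a≤b)

  ∣x∣²≈x² : ∀ x → ∣ x ∣ * ∣ x ∣ ≈ x * x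
  ∣x∣²≈x² x with ⊔-sel x (- x)
  ... | inj₁ ∣x∣≈x  = *-cong ∣x∣≈x ∣x∣≈x
  ... | inj₂ ∣x∣≈-x = trans (*-cong ∣x∣≈-x ∣x∣≈-x) (solve 1 (λ x → :- x :* :- x := x :* x) refl x)

  ∣sum∣≤ : ∀ {n} (f : Vector ℝ n) → ∣ sum f ∣ ≤ sum (λ i → ∣ f i ∣)
  ∣sum∣≤ {zero}  f = ∣0∣≤0
  ∣sum∣≤ {suc n} f = ≤-trans (∣x+y∣≤ _ _) (+-monoʳ-≤ _ (∣sum∣≤ (λ i → f (suc i))))

  term≤sum : ∀ {n} {f : Vector ℝ n} → (∀ i → 0# ≤ f i) → ∀ i → f i ≤ sum f
  term≤sum 0≤f zero    = x≤x+y (sum-nonNeg (λ i → 0≤f (suc i)))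
  term≤sum 0≤f (suc i) = ≤-trans (term≤sum (λ i → 0≤f (suc i)) i)
    (≤-trans (x≤x+y (0≤f zero)) (≤-reflexive (+-comm _ _)))

  *ᵥ-scale : ∀ {n d} (A : Matrix n d) c x i → (A *ᵥ (λ k → c * x k)) i ≈ c * (A *ᵥ x) i
  *ᵥ-scale A c x i = trans (sum-cong-≋ (λ k → solve 3 (λ a c x → a :* (c :* x) := c :* (a :* x)) refl (A i k) c (x k)))
    (sym (*-distribˡ-sum c (λ k → A i k * x k)))

  -- Gaussian elimination on columns: every vector of the column space that is small in the
  -- supremum norm has a small coefficient vector, whatever the rank of A.
  bounded-preimage : ∀ {n} d (A : Matrix n d) → ∃[ g ] 0# ≤ g × (∀ x m → 0# ≤ m → (∀ i → ∣ (A *ᵥ x) i ∣ ≤ m) →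
                     Σ[ x′ ∈ Vector ℝ d ] (∀ i → (A *ᵥ x′) i ≈ (A *ᵥ x) i) × (∀ k → ∣ x′ k ∣ ≤ g * m))
  bounded-preimage zero A = 0# , ≤-refl , λ x m _ _ → x , (λ i → refl) , λ ()
  bounded-preimage {n} (suc d) A with em {∃[ r ] ¬ (A r zero ≈ 0#)}
  ... | no ¬pivot = g , 0≤g , preimage
    where
    A′ : Matrix n d
    A′ i k = A i (suc k)
    IH = bounded-preimage d A′
    g = proj₁ IH
    0≤g = proj₁ (proj₂ IH)
    a≈0 : ∀ i → A i zero ≈ 0#
    a≈0 i with em {A i zero ≈ 0#}
    ... | yes p = p
    ... | no ¬p = ⊥-elim (¬pivot (i , ¬p))
    drop : ∀ i t s → A i zero * t + s ≈ s
    drop i t s = trans (+-congʳ (trans (*-congʳ (a≈0 i)) (zeroˡ t))) (+-identityˡ s)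
    preimage : ∀ x m → 0# ≤ m → (∀ i → ∣ (A *ᵥ x) i ∣ ≤ m) →
               Σ[ x′ ∈ Vector ℝ (suc d) ] (∀ i → (A *ᵥ x′) i ≈ (A *ᵥ x) i) × (∀ k → ∣ x′ k ∣ ≤ g * m)
    preimage x m 0≤m Ax≤m with proj₂ (proj₂ IH) (λ k → x (suc k)) m 0≤m
                                 (λ i → ≤-trans (≤-reflexive (∣∣-cong (sym (drop i (x zero) _)))) (Ax≤m i))
    ... | x″ , A′x″≈ , x″≤ = 0# Vector.∷ x″ ,
          (λ i → trans (drop i 0# _) (trans (A′x″≈ i) (sym (drop i (x zero) _)))) ,
          λ { zero → ≤-trans ∣0∣≤0 (*-nonNeg 0≤g 0≤m) ; (suc k) → x″≤ k }
  ... | yes (r , aᵣ≉0) = G , 0≤G , preimage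
    where
    open ≤-Reasoning
    a : Vector ℝ n
    a i = A i zero
    c = a r ⁻¹
    A′ A″ : Matrix n d
    A′ i k = A i (suc k)
    -- Subtracting multiples of the pivot column clears row `r`. Consequently `A″ *ᵥ v` is
    -- determined by `y = A *ᵥ x` alone, as y i - (a i / a r) y r, and is small whenever `y` is.
    A″ i k = A′ i k - a i * c * A′ r k
    IH = bounded-preimage d A″
    g = proj₁ IH
    0≤g = proj₁ (proj₂ IH)
    α = sum (λ i → ∣ a i * c ∣)
    0≤α : 0# ≤ α
    0≤α = sum-nonNeg (λ i → 0≤∣x∣ (a i * c))
    σ = sum (λ k → ∣ A′ r k ∣)
    0≤σ : 0# ≤ σ
    0≤σ = sum-nonNeg (λ k → 0≤∣x∣ (A′ r k))
    -- Per unit of `m`, `h` bounds the coordinates found recursively and `e` the pivot coordinate.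
    h = g * (1# + α)
    0≤h : 0# ≤ h
    0≤h = *-nonNeg 0≤g (+-nonNeg 0≤1 0≤α)
    e = ∣ c ∣ * (1# + σ * h)
    0≤e : 0# ≤ e
    0≤e = *-nonNeg (0≤∣x∣ c) (+-nonNeg 0≤1 (*-nonNeg 0≤σ 0≤h))
    G = h + e
    0≤G : 0# ≤ G
    0≤G = +-nonNeg 0≤h 0≤e
    reduce : ∀ v i → (A″ *ᵥ v) i ≈ (A′ *ᵥ v) i - a i * c * (A′ *ᵥ v) r
    reduce v i = trans (sum-cong-≋ (λ k → solve 4 (λ p s q v → (p :- s :* q) :* v := p :* v :- s :* (q :* v)) refl (A′ i k) (a i * c) (A′ r k) (v k)))
      (sum-linear (λ k → A′ i k * v k) (λ k → A′ r k * v k) (a i * c))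
    preimage : ∀ x m → 0# ≤ m → (∀ i → ∣ (A *ᵥ x) i ∣ ≤ m) →
               Σ[ x′ ∈ Vector ℝ (suc d) ] (∀ i → (A *ᵥ x′) i ≈ (A *ᵥ x) i) × (∀ k → ∣ x′ k ∣ ≤ G * m)
    preimage x m 0≤m Ax≤m = recover (proj₂ (proj₂ IH) v ((1# + α) * m) (*-nonNeg (+-nonNeg 0≤1 0≤α) 0≤m) A″v≤)
      where
      v : Vector ℝ d
      v k = x (suc k)
      y = A *ᵥ x
      A″v≈ : ∀ i → (A″ *ᵥ v) i ≈ y i - a i * c * y r
      A″v≈ i = trans (reduce v i) (sym (modulo (⁻¹-inverseʳ aᵣ≉0) (solve 6 (λ aᵢ aᵣ c t p q →
        aᵢ :* t :+ p :- aᵢ :* c :* (aᵣ :* t :+ q) := p :- aᵢ :* c :* q :+ (:- (aᵢ :* t)) :* (aᵣ :* c :- con (+ 1)))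
        refl (a i) (a r) c (x zero) ((A′ *ᵥ v) i) ((A′ *ᵥ v) r))))
      A″v≤ : ∀ i → ∣ (A″ *ᵥ v) i ∣ ≤ (1# + α) * m
      A″v≤ i = begin
        ∣ (A″ *ᵥ v) i ∣                 ≈⟨ ∣∣-cong (A″v≈ i) ⟩
        ∣ y i - a i * c * y r ∣         ≤⟨ ∣x-y∣≤ _ _ ⟩
        ∣ y i ∣ + ∣ a i * c * y r ∣     ≤⟨ +-mono-≤ (Ax≤m i) (≤-trans (∣x*y∣≤ _ _) (*-mono-≤ 0≤α (0≤∣x∣ (y r))
                                            (term≤sum {f = λ i → ∣ a i * c ∣} (λ i → 0≤∣x∣ (a i * c)) i) (Ax≤m r))) ⟩
        m + α * m                       ≈⟨ solve 2 (λ m α → m :+ α :* m := (con (+ 1) :+ α) :* m) refl m α ⟩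
        (1# + α) * m                    ∎
      recover : Σ[ x″ ∈ Vector ℝ d ] (∀ i → (A″ *ᵥ x″) i ≈ (A″ *ᵥ v) i) × (∀ k → ∣ x″ k ∣ ≤ g * ((1# + α) * m)) →
                Σ[ x′ ∈ Vector ℝ (suc d) ] (∀ i → (A *ᵥ x′) i ≈ (A *ᵥ x) i) × (∀ k → ∣ x′ k ∣ ≤ G * m)
      recover (x″ , A″x″≈ , x″≤) = t Vector.∷ x″ , Ax′≈ , x′≤
        where
        q = (A′ *ᵥ x″) r
        -- Solves row `r`, that is `a r * t + q ≈ y r`; the other rows then agree because the
        -- reduced systems do.
        t = c * (y r - q)
        x″≤hm : ∀ k → ∣ x″ k ∣ ≤ h * m
        x″≤hm k = ≤-trans (x″≤ k) (≤-reflexive (sym (*-assoc _ _ _)))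
        Ax′≈ : ∀ i → a i * t + (A′ *ᵥ x″) i ≈ y i
        Ax′≈ i = trans (solve 5 (λ aᵢ c yᵣ q p → aᵢ :* (c :* (yᵣ :- q)) :+ p := aᵢ :* c :* yᵣ :+ (p :- aᵢ :* c :* q))
                       refl (a i) c (y r) q ((A′ *ᵥ x″) i))
                     (trans (+-congˡ (trans (sym (reduce x″ i)) (trans (A″x″≈ i) (A″v≈ i))))
                       (solve 2 (λ s yᵢ → s :+ (yᵢ :- s) := yᵢ) refl (a i * c * y r) (y i)))
        q≤ : ∣ q ∣ ≤ σ * (h * m)
        q≤ = begin
          ∣ q ∣                                   ≤⟨ ∣sum∣≤ (λ k → A′ r k * x″ k) ⟩
          sum (λ k → ∣ A′ r k * x″ k ∣)           ≤⟨ sum-mono-≤ (λ k → ≤-trans (∣x*y∣≤ _ _) (*-monoʳ-≤ (0≤∣x∣ (A′ r k)) (x″≤hm k))) ⟩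
          sum (λ k → ∣ A′ r k ∣ * (h * m))        ≈⟨ sym (*-distribʳ-sum (h * m) (λ k → ∣ A′ r k ∣)) ⟩
          σ * (h * m)                             ∎
        x′≤ : ∀ k → ∣ (t Vector.∷ x″) k ∣ ≤ G * m
        x′≤ zero = begin
          ∣ c * (y r - q) ∣                       ≤⟨ ∣x*y∣≤ _ _ ⟩
          ∣ c ∣ * ∣ y r - q ∣                     ≤⟨ *-monoʳ-≤ (0≤∣x∣ c) (≤-trans (∣x-y∣≤ _ _) (+-mono-≤ (Ax≤m r) q≤)) ⟩
          ∣ c ∣ * (m + σ * (h * m))               ≈⟨ solve 4 (λ c m σ h → c :* (m :+ σ :* (h :* m)) := c :* (con (+ 1) :+ σ :* h) :* m) refl ∣ c ∣ m σ h ⟩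
          e * m                                   ≤⟨ *-monoˡ-≤ 0≤m (≤-trans (x≤x+y 0≤h) (≤-reflexive (+-comm e h))) ⟩
          G * m                                   ∎
        x′≤ (suc k) = ≤-trans (x″≤hm k) (*-monoˡ-≤ 0≤m (x≤x+y 0≤e))

  -- ℓₚ norms

  ^ᴿ-scaled-≤ : ∀ {s c x y a} → 0# < a → 0# < c → 0# ≤ x → 0# ≤ y → c ^ᴿ a ≈ s → c * x ≤ y → s * x ^ᴿ a ≤ y ^ᴿ a
  ^ᴿ-scaled-≤ {s} {c} {x} {y} {a} 0<a 0<c 0≤x 0≤y cᵃ≈s cx≤y with ≤⊎< x 0#
  ... | inj₁ x≤0 = begin
        s * x ^ᴿ a         ≈⟨ *-congʳ (sym cᵃ≈s) ⟩
        c ^ᴿ a * x ^ᴿ a    ≤⟨ *-monoʳ-≤ (^ᴿ-nonNeg (<⇒≤ 0<c) (<⇒≤ 0<a)) (^ᴿ-zero 0≤x x≤0 0<a) ⟩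
        c ^ᴿ a * 0#        ≈⟨ zeroʳ _ ⟩
        0#                 ≤⟨ ^ᴿ-nonNeg 0≤y (<⇒≤ 0<a) ⟩
        y ^ᴿ a             ∎
        where open ≤-Reasoning
  ... | inj₂ 0<x = begin
        s * x ^ᴿ a         ≈⟨ *-congʳ (sym cᵃ≈s) ⟩
        c ^ᴿ a * x ^ᴿ a    ≈⟨ sym (^ᴿ-distrib-* 0<c 0<x (<⇒≤ 0<a)) ⟩
        (c * x) ^ᴿ a       ≤⟨ ^ᴿ-monoˡ-≤ 0<a (*-nonNeg (<⇒≤ 0<c) 0≤x) cx≤y ⟩
        y ^ᴿ a             ∎
        where open ≤-Reasoning

  module _ {p : ℝ} (1≤p : 1# ≤ p) where

    0<p : 0# < p
    0<p = <-≤-trans 0<1 1≤p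

    0≤p : 0# ≤ p
    0≤p = <⇒≤ 0<p

    0<p⁻¹ : 0# < p ⁻¹
    0<p⁻¹ = 0<⁻¹ 0<p

    -- The p-th power of the norm. Membership in the unit ball is expressed through it, so that no
    -- root intervenes.
    power-sum : ∀ {n} → Vector ℝ n → ℝ
    power-sum y = sum (λ i → ∣ y i ∣ ^ᴿ p)

    0≤∣∣^p : ∀ x → 0# ≤ ∣ x ∣ ^ᴿ p
    0≤∣∣^p x = ^ᴿ-nonNeg (0≤∣x∣ x) 0≤p

    power-sum-nonNeg : ∀ {n} (y : Vector ℝ n) → 0# ≤ power-sum y
    power-sum-nonNeg y = sum-nonNeg (λ i → 0≤∣∣^p (y i))

    power-sum-cong : ∀ {n} {x y : Vector ℝ n} → (∀ i → x i ≈ y i) → power-sum x ≈ power-sum y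
    power-sum-cong {x = x} x≈y = sum-cong-≋ (λ i → ^ᴿ-congˡ 0<p (0≤∣x∣ (x i)) (∣∣-cong (x≈y i)))

    norm-cong : ∀ {n} {x y : Vector ℝ n} → (∀ i → x i ≈ y i) → ‖ x ‖[ p ] ≈ ‖ y ‖[ p ]
    norm-cong {x = x} x≈y = ^ᴿ-congˡ 0<p⁻¹ (power-sum-nonNeg x) (power-sum-cong x≈y)

    norm-nonNeg : ∀ {n} (x : Vector ℝ n) → 0# ≤ ‖ x ‖[ p ]
    norm-nonNeg x = ^ᴿ-nonNeg (power-sum-nonNeg x) (<⇒≤ 0<p⁻¹)

    entry^p≤power-sum : ∀ {n} (y : Vector ℝ n) i → ∣ y i ∣ ^ᴿ p ≤ power-sum y
    entry^p≤power-sum y = term≤sum (λ i → 0≤∣∣^p (y i))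

    power-sum≤1⇒entry≤1 : ∀ {n} (y : Vector ℝ n) → power-sum y ≤ 1# → ∀ i → ∣ y i ∣ ≤ 1#
    power-sum≤1⇒entry≤1 y y≤1 i with total (∣ y i ∣) 1#
    ... | inj₁ ∣yᵢ∣≤1 = ∣yᵢ∣≤1
    ... | inj₂ 1≤∣yᵢ∣ = ≤-trans (base≤^ᴿ 1≤∣yᵢ∣ 1≤p) (≤-trans (entry^p≤power-sum y i) y≤1)

    power-sum≤0⇒entry≈0 : ∀ {n} (y : Vector ℝ n) → power-sum y ≤ 0# → ∀ i → y i ≈ 0#
    power-sum≤0⇒entry≈0 y y≤0 i with ≤⊎< ∣ y i ∣ 0#
    ... | inj₁ ∣yᵢ∣≤0 = ∣x∣≤0⇒x≈0 ∣yᵢ∣≤0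
    ... | inj₂ 0<∣yᵢ∣ = ⊥-elim (^ᴿ-positive 0<∣yᵢ∣ 0≤p (≤-trans (entry^p≤power-sum y i) y≤0))

    power-sum-zero : ∀ {n} (y : Vector ℝ n) → (∀ i → y i ≈ 0#) → power-sum y ≤ 0#
    power-sum-zero {n} y y≈0 = ≤-trans
      (sum-mono-≤ (λ i → ^ᴿ-zero (0≤∣x∣ (y i)) (≤-trans (≤-reflexive (∣∣-cong (y≈0 i))) ∣0∣≤0) 0<p))
      (≤-reflexive (sum-replicate-zero n))

    -- Since ν ^ p = S, multiplying each |q i| ^ p by `S` gives at most |y i| ^ p. These bounds add
    -- up to `S`, which is then cancelled.
    power-sum-normalise : ∀ {n} (y : Vector ℝ n) → 0# < power-sum y → power-sum (λ i → ‖ y ‖[ p ] ⁻¹ * y i) ≤ 1#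
    power-sum-normalise y 0<S = *-cancelˡ-≤ 0<S (begin
      S * power-sum q                      ≈⟨ *-distribˡ-sum S (λ i → ∣ q i ∣ ^ᴿ p) ⟩
      sum (λ i → S * ∣ q i ∣ ^ᴿ p)         ≤⟨ sum-mono-≤ entry ⟩
      S                                    ≈⟨ sym (*-identityʳ S) ⟩
      S * 1#                               ∎)
      where
      open ≤-Reasoning
      S = power-sum y
      ν = ‖ y ‖[ p ]
      0<ν : 0# < ν
      0<ν = ^ᴿ-positive 0<S (<⇒≤ 0<p⁻¹)
      q : Vector ℝ _
      q i = ν ⁻¹ * y i
      ν∣q∣≤∣y∣ : ∀ i → ν * ∣ q i ∣ ≤ ∣ y i ∣
      ν∣q∣≤∣y∣ i = begin
        ν * ∣ ν ⁻¹ * y i ∣            ≤⟨ *-monoʳ-≤ (<⇒≤ 0<ν) (∣x*y∣≤ _ _) ⟩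
        ν * (∣ ν ⁻¹ ∣ * ∣ y i ∣)      ≤⟨ *-monoʳ-≤ (<⇒≤ 0<ν) (*-monoˡ-≤ (0≤∣x∣ (y i)) (nonNeg⇒∣x∣≤x (<⇒≤ (0<⁻¹ 0<ν)))) ⟩
        ν * (ν ⁻¹ * ∣ y i ∣)          ≈⟨ sym (*-assoc _ _ _) ⟩
        ν * ν ⁻¹ * ∣ y i ∣            ≈⟨ *-congʳ (⁻¹-inverseʳ (>⇒≉ 0<ν)) ⟩
        1# * ∣ y i ∣                  ≈⟨ *-identityˡ _ ⟩
        ∣ y i ∣                       ∎
      entry : ∀ i → S * ∣ q i ∣ ^ᴿ p ≤ ∣ y i ∣ ^ᴿ p
      entry i = ^ᴿ-scaled-≤ 0<p 0<ν (0≤∣x∣ (q i)) (0≤∣x∣ (y i)) (^ᴿ-inverse 0<S 0<p) (ν∣q∣≤∣y∣ i)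

  norm₂-≤ : ∀ {n} (z : Vector ℝ n) {c} → 0# ≤ c → sum (λ i → z i * z i) ≤ c * c → ‖ z ‖₂ ≤ c
  norm₂-≤ z 0≤c z²≤c² = sqrt-≤ (sum-nonNeg (λ i → ^ᴿ-nonNeg (0≤∣x∣ (z i)) (<⇒≤ 0<2))) 0≤c
    (≤-trans (≤-reflexive (sum-cong-≋ (λ i → trans (^ᴿ-2 (0≤∣x∣ (z i))) (∣x∣²≈x² (z i))))) z²≤c²)

  square-mono-≤ : ∀ {x c} → ∣ x ∣ ≤ c → x * x ≤ c * c
  square-mono-≤ {x} {c} ∣x∣≤c = ≤-trans (≤-reflexive (sym (∣x∣²≈x² x)))
    (*-mono-≤ (≤-trans (0≤∣x∣ x) ∣x∣≤c) (0≤∣x∣ x) ∣x∣≤c ∣x∣≤c)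

  -- Construction of the spanning columns

  SpanningColumns : ∀ {n d} → Matrix n d → ℝ → ∀ {s} → Matrix n s → Set
  SpanningColumns {n} {d} A p {s} U =
    (‖ U ‖ₑ[ p ] ≤ fromℕ s ^ᴿ (p ⁻¹))
    × (∀ (x : Vector ℝ d) → Σ[ z ∈ Vector ℝ s ] (∀ i → (A *ᵥ x) i ≈ (U *ᵥ z) i) × (‖ z ‖₂ ≤ fromℕ 2 * ‖ U *ᵥ z ‖[ p ]))

  spanning-columns : ∀ {n d} (A : Matrix n d) {p} → 1# ≤ p → 0 ℕ.< d →
                     Σ[ s ∈ ℕ ] Σ[ U ∈ Matrix n s ] s ≡ 3 ℕ.* d ℕ.+ d × SpanningColumns A p U
  spanning-columns {n} {d} A {p} 1≤p 0<d = construct (well-conditioned 0<d)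
    where
    open ≤-Reasoning
    -- With δ = 1 / (1 + τ), every image A (δ eₖ) has ℓ₁ norm at most τ δ ≤ 1.
    τ = sum (λ i → sum (λ k → ∣ A i k ∣))
    0≤rows : ∀ i → 0# ≤ sum (λ k → ∣ A i k ∣)
    0≤rows i = sum-nonNeg (λ k → 0≤∣x∣ (A i k))
    0≤τ : 0# ≤ τ
    0≤τ = sum-nonNeg 0≤rows
    δ = (1# + τ) ⁻¹
    0<δ : 0# < δ
    0<δ = 0<⁻¹ (0<1+ 0≤τ)
    open Forms d δ 0<δ

    τδ≤1 : τ * δ ≤ 1#
    τδ≤1 = ≤-trans (*-monoˡ-≤ (<⇒≤ 0<δ) (≤-trans (x≤x+y 0≤1) (≤-reflexive (+-comm τ 1#)))) (≤-reflexive (⁻¹-inverseʳ (>⇒≉ (0<1+ 0≤τ))))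

    unit∈ball : ∀ k → power-sum 1≤p (A *ᵥ scaled-unit δ k) ≤ 1#
    unit∈ball k = begin
      -- The entries are at most 1 in absolute value, so their p-th powers do not exceed them and an
      -- ℓ₁ bound serves every p ≥ 1.
      power-sum 1≤p (A *ᵥ scaled-unit δ k)      ≤⟨ sum-mono-≤ (λ i → ≤-trans (^ᴿ≤base (0≤∣x∣ _) (≤-trans (entry i) (≤-trans (single i) τδ≤1)) 1≤p) (entry i)) ⟩
      sum (λ i → sum (λ k → ∣ A i k ∣) * δ)     ≈⟨ sym (*-distribʳ-sum δ (λ i → sum (λ k → ∣ A i k ∣))) ⟩
      τ * δ                                     ≤⟨ τδ≤1 ⟩
      1#                                        ∎
      where
      single : ∀ i → sum (λ k → ∣ A i k ∣) * δ ≤ τ * δ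
      single i = *-monoˡ-≤ (<⇒≤ 0<δ) (term≤sum 0≤rows i)
      entry : ∀ i → ∣ (A *ᵥ scaled-unit δ k) i ∣ ≤ sum (λ k → ∣ A i k ∣) * δ
      entry i = begin
        ∣ (A *ᵥ scaled-unit δ k) i ∣      ≈⟨ ∣∣-cong (sum-scaled-unit δ k (A i)) ⟩
        ∣ A i k * δ ∣                     ≤⟨ ∣x*y∣≤ _ _ ⟩
        ∣ A i k ∣ * ∣ δ ∣                 ≤⟨ *-mono-≤ (0≤rows i) (0≤∣x∣ δ) (term≤sum (λ k → 0≤∣x∣ (A i k)) k)
                                               (nonNeg⇒∣x∣≤x (<⇒≤ 0<δ)) ⟩
        sum (λ k → ∣ A i k ∣) * δ         ∎

    preimages = bounded-preimage d A
    -- The factor `1#` keeps the shape of the bound in `bounded-preimage` at `m = 1#`.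
    g = proj₁ preimages * 1#
    0≤g : 0# ≤ g
    0≤g = *-nonNeg (proj₁ (proj₂ preimages)) 0≤1

    -- The coordinate bound makes the volumes bounded even if `A` has a kernel. Every image in the
    -- unit ball still comes from a member, because its entries are at most 1 and `g` is the
    -- preimage bound for that case.
    K : Vector ℝ d → Set
    K u = power-sum 1≤p (A *ᵥ u) ≤ 1# × (∀ k → ∣ u k ∣ ≤ g)

    zero-vector : Vector ℝ d
    zero-vector _ = 0#

    zero∈K : K zero-vector
    zero∈K = ≤-trans (power-sum-zero 1≤p (A *ᵥ zero-vector) (λ i → trans (sym (*-distribʳ-sum 0# (A i))) (zeroʳ _))) 0≤1 ,
             λ k → ≤-trans ∣0∣≤0 0≤g

    B = sum {d} (λ _ → (δ ⁻¹ * δ ⁻¹) * (g * g))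

    K-bounded : ∀ {u} → K u → form [] u u ≤ B
    K-bounded {u} (_ , u≤g) = sum-mono-≤ (λ k → ≤-trans
      (≤-reflexive (solve 2 (λ e u → e :* u :* (e :* u) := e :* e :* (u :* u)) refl (δ ⁻¹) (u k)))
      (*-monoʳ-≤ (0≤x² (δ ⁻¹)) (square-mono-≤ (u≤g k))))

    open Exchange K B (sum-nonNeg {d} (λ _ → *-nonNeg (0≤x² (δ ⁻¹)) (0≤x² g))) K-bounded zero-vector zero∈K

    frame∈ball : ∀ us → All K us → ∀ j → power-sum 1≤p (A *ᵥ frame us j) ≤ 1#
    frame∈ball []       []          k       = unit∈ball k
    frame∈ball (u ∷ us) (u∈K ∷ _)   zero    = proj₁ u∈K
    frame∈ball (u ∷ us) (_ ∷ us∈K)  (suc j) = frame∈ball us us∈K j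

    construct : ∃[ us ] length us ≡ 3 ℕ.* d × All K us × (∀ y → K y → form us y y ≤ fromℕ 4) →
                Σ[ s ∈ ℕ ] Σ[ U ∈ Matrix n s ] s ≡ 3 ℕ.* d ℕ.+ d × SpanningColumns A p U
    construct (us , |us| , us∈K , conditioned) = s , U , ≡.cong (ℕ._+ d) |us| , U-small , represent
      where
      s = length us ℕ.+ d
      w : Vector (Vector ℝ d) s
      w = frame us
      U : Matrix n s
      U i j = (A *ᵥ w j) i

      U-small : ‖ U ‖ₑ[ p ] ≤ fromℕ s ^ᴿ (p ⁻¹)
      U-small = ^ᴿ-monoˡ-≤ (0<p⁻¹ 1≤p) (sum-nonNeg (λ i → power-sum-nonNeg 1≤p (U i))) (begin
        sum (λ i → sum (λ j → ∣ U i j ∣ ^ᴿ p))     ≈⟨ ∑-comm (λ i j → ∣ U i j ∣ ^ᴿ p) ⟩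
        sum (λ j → power-sum 1≤p (A *ᵥ w j))       ≤⟨ sum-mono-≤ (frame∈ball us us∈K) ⟩
        sum {s} (λ _ → 1#)                         ≈⟨ sum-replicate s ⟩
        fromℕ s                                    ∎)

      -- `U` is `A` times the matrix W whose columns are the frame vectors, and by `frame-expansion`
      -- W carries the coefficients back to `x`.
      combine : ∀ c x i → (U *ᵥ (λ j → c * form us x (w j))) i ≈ c * (A *ᵥ x) i
      combine c x i = trans (*ᵥ-scale U c (λ j → form us x (w j)) i) (*-congˡ (begin-equality
        sum (λ j → sum (λ k → A i k * w j k) * ζ j)       ≈⟨ sum-cong-≋ (λ j → *-distribʳ-sum (ζ j) (λ k → A i k * w j k)) ⟩
        sum (λ j → sum (λ k → A i k * w j k * ζ j))       ≈⟨ ∑-comm (λ j k → A i k * w j k * ζ j) ⟩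
        sum (λ k → sum (λ j → A i k * w j k * ζ j))       ≈⟨ sum-cong-≋ (λ k → trans
          (sum-cong-≋ (λ j → solve 3 (λ a w z → a :* w :* z := a :* (z :* w)) refl (A i k) (w j k) (ζ j)))
          (trans (sym (*-distribˡ-sum (A i k) (λ j → ζ j * w j k))) (*-congˡ (frame-expansion us x k)))) ⟩
        sum (λ k → A i k * x k)                           ∎))
        where
        ζ : Vector ℝ s
        ζ j = form us x (w j)

      coefficients : ∀ c x → K x → 0# ≤ c → ‖ (λ j → c * form us x (w j)) ‖₂ ≤ fromℕ 2 * c
      coefficients c x x∈K 0≤c = norm₂-≤ (λ j → c * form us x (w j)) (*-nonNeg (0≤fromℕ 2) 0≤c) (begin
        sum (λ j → c * form us x (w j) * (c * form us x (w j)))       ≈⟨ sum-cong-≋ (λ j → trans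
          (solve 2 (λ c z → c :* z :* (c :* z) := c :* c :* (z :* z)) refl c (form us x (w j)))
          (*-congˡ (*-congˡ (form-sym us x (w j))))) ⟩
        sum (λ j → c * c * (form us x (w j) * form us (w j) x))       ≈⟨ sym (*-distribˡ-sum (c * c) (λ j → form us x (w j) * form us (w j) x)) ⟩
        c * c * sum (λ j → form us x (w j) * form us (w j) x)         ≈⟨ *-congˡ (form-reproducing us x x) ⟩
        c * c * form us x x                                           ≤⟨ *-monoʳ-≤ (0≤x² c) (conditioned x x∈K) ⟩
        c * c * fromℕ 4                                               ≈⟨ solve 1 (λ c → c :* c :* (con (+ 1) :+ (con (+ 1) :+ (con (+ 1) :+ (con (+ 1) :+ con (+ 0))))) :=
                                                                           (con (+ 1) :+ (con (+ 1) :+ con (+ 0))) :* c :* ((con (+ 1) :+ (con (+ 1) :+ con (+ 0))) :* c)) refl c ⟩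
        fromℕ 2 * c * (fromℕ 2 * c)                                   ∎)

      Representation : Vector ℝ d → Set
      Representation x = Σ[ z ∈ Vector ℝ s ] (∀ i → (A *ᵥ x) i ≈ (U *ᵥ z) i) × (‖ z ‖₂ ≤ fromℕ 2 * ‖ U *ᵥ z ‖[ p ])

      -- Here `A *ᵥ x` vanishes and cannot be normalised. The scale `c = 0#` lets the general
      -- estimates cover the zero coefficients.
      represent-zero : ∀ x → power-sum 1≤p (A *ᵥ x) ≤ 0# → Representation x
      represent-zero x S≤0 = z , Ax≈Uz , ≤-trans (coefficients 0# zero-vector zero∈K ≤-refl)
        (≤-trans (≤-reflexive (zeroʳ _)) (*-nonNeg (0≤fromℕ 2) (norm-nonNeg 1≤p (U *ᵥ z))))
        where
        z : Vector ℝ s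
        z j = 0# * form us zero-vector (w j)
        Ax≈Uz : ∀ i → (A *ᵥ x) i ≈ (U *ᵥ z) i
        Ax≈Uz i = trans (power-sum≤0⇒entry≈0 1≤p (A *ᵥ x) S≤0 i) (sym (trans (combine 0# zero-vector i) (zeroˡ _)))

      represent-nonzero : ∀ x → 0# < power-sum 1≤p (A *ᵥ x) → Representation x
      -- The normalised `x̂` may violate the coordinate bound of `K`, so it is replaced by an `x′`
      -- with the same image; multiplying the coefficients by ν restores the scale.
      represent-nonzero x 0<S = from-preimage (proj₂ (proj₂ preimages) x̂ 1# 0≤1
          (power-sum≤1⇒entry≤1 1≤p (A *ᵥ x̂) (≤-trans (≤-reflexive (power-sum-cong 1≤p (*ᵥ-scale A (ν ⁻¹) x))) (power-sum-normalise 1≤p y 0<S))))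
        where
        y = A *ᵥ x
        ν = ‖ y ‖[ p ]
        0<ν : 0# < ν
        0<ν = ^ᴿ-positive 0<S (<⇒≤ (0<p⁻¹ 1≤p))
        x̂ : Vector ℝ d
        x̂ k = ν ⁻¹ * x k
        from-preimage : Σ[ x′ ∈ Vector ℝ d ] (∀ i → (A *ᵥ x′) i ≈ (A *ᵥ x̂) i) × (∀ k → ∣ x′ k ∣ ≤ g) → Representation x
        from-preimage (x′ , Ax′≈ , x′≤g) = z , y≈Uz ,
          ≤-trans (coefficients ν x′ x′∈K (<⇒≤ 0<ν)) (≤-reflexive (*-congˡ (norm-cong 1≤p y≈Uz)))
          where
          Ax′≈y/ν : ∀ i → (A *ᵥ x′) i ≈ ν ⁻¹ * y i
          Ax′≈y/ν i = trans (Ax′≈ i) (*ᵥ-scale A (ν ⁻¹) x i)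
          x′∈K : K x′
          x′∈K = ≤-trans (≤-reflexive (power-sum-cong 1≤p Ax′≈y/ν)) (power-sum-normalise 1≤p y 0<S) , x′≤g
          z : Vector ℝ s
          z j = ν * form us x′ (w j)
          y≈Uz : ∀ i → y i ≈ (U *ᵥ z) i
          y≈Uz i = sym (begin-equality
            (U *ᵥ z) i              ≈⟨ combine ν x′ i ⟩
            ν * (A *ᵥ x′) i         ≈⟨ *-congˡ (Ax′≈y/ν i) ⟩
            ν * (ν ⁻¹ * y i)        ≈⟨ sym (*-assoc _ _ _) ⟩
            ν * ν ⁻¹ * y i          ≈⟨ *-congʳ (⁻¹-inverseʳ (>⇒≉ 0<ν)) ⟩
            1# * y i                ≈⟨ *-identityˡ _ ⟩
            y i                     ∎)

      represent : ∀ x → Representation x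
      represent x = [ represent-zero x , represent-nonzero x ]′ (≤⊎< (power-sum 1≤p (A *ᵥ x)) 0#)

  -- The strict inequality 2d < 3d behind `small-vector` fails for d = 0, so this case is separate;
  -- the empty matrix represents itself.
  no-columns : ∀ {n} (A : Matrix n 0) {p} → 1# ≤ p → SpanningColumns A p {0} A
  no-columns {n} A 1≤p =
    ^ᴿ-monoˡ-≤ (0<p⁻¹ 1≤p) (sum-nonNeg (λ i → power-sum-nonNeg 1≤p (A i))) (≤-reflexive (sum-replicate-zero n)) ,
    λ x → x , (λ i → refl) , norm₂-≤ x (*-nonNeg (0≤fromℕ 2) (norm-nonNeg 1≤p (A *ᵥ x))) (0≤x² _)

  4d≤4d·loglog : ∀ d → 4 ℕ.* d ℕ.≤ 4 ℕ.* (d ℕ.* loglog d)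
  4d≤4d·loglog d = ℕ.*-monoʳ-≤ 4 (ℕ.≤-trans (ℕ.≤-reflexive (≡.sym (ℕ.*-identityʳ d))) (ℕ.*-monoʳ-≤ d (ℕ.m≤m⊔n 1 ⌊log₂ ⌊log₂ d ⌋ ⌋)))

  few-spanning-columns : ∀ n d (A : Matrix n d) p → 1# ≤ p →
    Σ[ s ∈ ℕ ] Σ[ U ∈ Matrix n s ] (s ℕ.≤ 4 ℕ.* (d ℕ.* loglog d)) × SpanningColumns A p U
  few-spanning-columns n zero      A p 1≤p = 0 , A , ℕ.z≤n , no-columns A 1≤p
  few-spanning-columns n d@(suc _) A p 1≤p = count (spanning-columns A 1≤p (ℕ.s≤s ℕ.z≤n))
    where
    count : Σ[ s ∈ ℕ ] Σ[ U ∈ Matrix n s ] s ≡ 3 ℕ.* d ℕ.+ d × SpanningColumns A p U →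
            Σ[ s ∈ ℕ ] Σ[ U ∈ Matrix n s ] (s ℕ.≤ 4 ℕ.* (d ℕ.* loglog d)) × SpanningColumns A p U
    count (s , U , s≡ , spanning) = s , U , ℕ.≤-trans (ℕ.≤-reflexive (≡.trans s≡ (ℕ.+-comm (3 ℕ.* d) d))) (4d≤4d·loglog d) , spanning

theorem1p11 : (em : ExcludedMiddle 0ℓ) (R : CompleteOrderedField) →
    let open RealAnalysis em R in
    Σ[ C₁ ∈ ℕ ] Σ[ C₂ ∈ ℝ ]
    ∀ (n d : ℕ) (A : Matrix n d) (p : ℝ) → 1# ≤ p →
    Σ[ s ∈ ℕ ] Σ[ U ∈ Matrix n s ]
    (s ≤ℕ C₁ *ℕ (d *ℕ loglog d))
    × (‖ U ‖ₑ[ p ] ≤ fromℕ s ^ᴿ (p ⁻¹))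
    × (∀ (x : Vector ℝ d) → Σ[ z ∈ Vector ℝ s ]
    (∀ i → (A *ᵥ x) i ≈ (U *ᵥ z) i)
    × (‖ z ‖₂ ≤ C₂ * ‖ U *ᵥ z ‖[ p ]))
theorem1p11 em R = 4 , fromℕ 2 , few-spanning-columns
  where
  open RealAnalysis em R using (fromℕ)
  open Development em R using (few-spanning-columns)
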